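{- For every integer $n\ge 2$ and all integers $r,k\in\mathbb{Z}$, $$n\,s_{n}^{(r,k)}(x)+n\left(\frac{1}{2}r-x\right)s_{n-1}^{(r,k)}(x)+r\sum_{l=0}^{n-2}(-1)^{n-l}\binom{n}{l}B_{n-l}\,s_{l}^{(r,k)}(x)=-s_{n}^{(r+1,k)}(x)+s_{n}^{(r+1,k-1)}(x)$$ as polynomials in $x$.
   Context: For $k\in\mathbb{Z}$, $Li_k(x)=\sum_{n=1}^{\infty}\frac{x^n}{n^k}$ is the polylogarithm, regarded as a formal power series; $\frac{Li_k(1-e^{ -t})}{1-e^{ -t}}$ is then a formal power series in $t$ over $\mathbb{C}$. The ordinary Bernoulli numbers $B_n$ are defined by $\frac{t}{e^t-1}=\sum_{n\ge0}B_n\frac{t^n}{n!}$ (so $B_1=-\tfrac12$). For $r,k\in\mathbb{Z}$, the higher-order Bernoulli and poly-Bernoulli mixed type polynomials $s_n^{(r,k)}(x)$ are defined by $\left(\frac{t}{e^t-1}\right)^r\frac{Li_k(1-e^{ -t})}{1-e^{ -t}}e^{xt}=\sum_{n\ge0}s_n^{(r,k)}(x)\frac{t^n}{n!}$. -}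

module Defs where

open import Algebra.Bundles using (CommutativeRing; RawRing; Semiring)
import Algebra.Definitions.RawSemiring as RawSemiringDefinitions
open import Data.Fin.Base using (toℕ)
open import Data.Integer.Base using (ℤ; +_; -[1+_])
open import Data.List.Base using (List; []; _∷_; map)
open import Data.Nat.Base using (ℕ; zero; suc; _∸_; _!; NonZero)
open import Data.Nat.Properties using (_!≢0)
open import Function.Base using (_∘_)
open import Level using (Level; _⊔_) renaming (suc to lsuc)

private
  variable
    c ℓ : Level

-- The coefficient domain: a commutative ring in which every positive integer
-- is invertible, that is, a commutative ℚ-algebra.  Every field of
-- characteristic zero is one, in particular ℚ and ℂ.
record CommutativeℚAlgebra c ℓ : Set (lsuc (c ⊔ ℓ)) where
  field
    commutativeRing : CommutativeRing c ℓ

  open CommutativeRing commutativeRing public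
  open RawSemiringDefinitions (Semiring.rawSemiring semiring) public using (_×_)

  field
    ⅟         : (n : ℕ) .{{_ : NonZero n}} → Carrier
    ⅟-inverse : (n : ℕ) .{{_ : NonZero n}} → (n × 1#) * ⅟ n ≈ 1#

module RingNotation (R : RawRing c ℓ) where
  open RawRing R public
  open RawSemiringDefinitions rawSemiring public using (_×_; _^_; sum)

  infixl 6 _-_
  _-_ : Carrier → Carrier → Carrier
  a - b = a + (- b)

  fromℤ : ℤ → Carrier
  fromℤ (+ n)    = n × 1#
  fromℤ -[1+ n ] = - (suc n × 1#)

  -- zpow a b k is the k-th power of a, where b is the inverse of a.
  zpow : Carrier → Carrier → ℤ → Carrier
  zpow a b (+ n)    = a ^ n
  zpow a b -[1+ n ] = b ^ suc n

  sumUpTo : ℕ → (ℕ → Carrier) → Carrier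
  sumUpTo n f = sum {suc n} (f ∘ toℕ)

  infixl 10 sumUpTo
  syntax sumUpTo n (λ i → a) = ∑[ i ≤ n ] a

-- Lists of coefficients, constant term first; trailing zeros are allowed, so
-- equality is equality of all coefficients rather than of lists.
module Polynomial (R : RawRing c ℓ) where
  private module R = RawRing R

  Poly : Set c
  Poly = List R.Carrier

  coeff : Poly → ℕ → R.Carrier
  coeff []      _       = R.0#
  coeff (a ∷ p) zero    = a
  coeff (a ∷ p) (suc n) = coeff p n

  const : R.Carrier → Poly
  const a = a ∷ []

  X : Poly
  X = R.0# ∷ R.1# ∷ []

  add : Poly → Poly → Poly
  add []      q       = q
  add (a ∷ p) []      = a ∷ p
  add (a ∷ p) (b ∷ q) = (a R.+ b) ∷ add p q

  mul : Poly → Poly → Poly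
  mul []      q = []
  mul (a ∷ p) q = add (map (a R.*_) q) (R.0# ∷ mul p q)

  polyRing : RawRing c ℓ
  polyRing = record
    { Carrier = Poly
    ; _≈_     = λ p q → ∀ n → coeff p n R.≈ coeff q n
    ; _+_     = add
    ; _*_     = mul
    ; -_      = map (λ a → R.- a)
    ; 0#      = []
    ; 1#      = const R.1#
    }

module PowerSeries (R : RawRing c ℓ) where
  private module R = RingNotation R
  open R using (sumUpTo)

  Series : Set c
  Series = ℕ → R.Carrier

  scalar : R.Carrier → Series
  scalar a zero    = a
  scalar a (suc _) = R.0#

  seriesRing : RawRing c ℓ
  seriesRing = record
    { Carrier = Series
    ; _≈_     = λ f g → ∀ n → f n R.≈ g n
    ; _+_     = λ f g n → f n R.+ g n
    ; _*_     = λ f g n → ∑[ i ≤ n ] (f i R.* g (n ∸ i))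
    ; -_      = λ f n → R.- f n
    ; 0#      = scalar R.0#
    ; 1#      = scalar R.1#
    }

  open RingNotation seriesRing public
    using (_+_; _*_; -_; _-_; 0#; 1#; _^_; zpow; _≈_)

  -- The variable t.
  T : Series
  T zero          = R.0#
  T (suc zero)    = R.1#
  T (suc (suc _)) = R.0#

  -- Composition f(u(t)) = Σₘ fₘ u(t)ᵐ, for u with zero constant term: the
  -- truncation at m ≤ n is exact because uᵐ has no terms of degree below m.
  infixl 8 _⟪_⟫
  _⟪_⟫ : Series → Series → Series
  (f ⟪ u ⟫) n = ∑[ m ≤ n ] (f m R.* (u ^ m) n)

  -- The inverse of a series f with constant term 1: the geometric series
  -- Σₘ (1 - f)ᵐ.
  inverse : Series → Series
  inverse f = (λ _ → R.1#) ⟪ 1# - f ⟫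

  divT : Series → Series
  divT f n = f (suc n)

  -- The quotient f / g, for f with zero constant term and g = t + O(t²): both
  -- are divided by t, after which the denominator has constant term 1.
  infixl 7 _/_
  _/_ : Series → Series → Series
  f / g = divT f * inverse (divT g)

-- exp a is the series e^{at}, for an element a of a ring in which ⅟ n is the
-- inverse of n.
module Exponential
  (R : RawRing c ℓ) (⅟ : (n : ℕ) .{{_ : NonZero n}} → RawRing.Carrier R) where
  open RingNotation R

  exp : Carrier → ℕ → Carrier
  exp a n = ⅟ (n !) {{n !≢0}} * a ^ n

module PolyBernoulli (K : CommutativeℚAlgebra c ℓ) where
  open CommutativeℚAlgebra K using (rawRing; ⅟)

  private
    module K    = RingNotation rawRing
    module K[t] = PowerSeries rawRing

  open Polynomial rawRing public using (Poly; coeff; const; X; polyRing)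

  private
    module K[x]    = RingNotation polyRing
    module K[x][t] = PowerSeries polyRing

    module ExpK    = Exponential rawRing ⅟
    module ExpK[x] = Exponential polyRing (λ n → const (⅟ n))

  e^t e^-t : K[t].Series
  e^t  = ExpK.exp K.1#
  e^-t = ExpK.exp (K.- K.1#)

  e^xt : K[x][t].Series
  e^xt = ExpK[x].exp X

  -- The coefficient at n ≥ 1 is n⁻ᵏ, which is zpow applied to 1/n and n.
  Li : ℤ → K[t].Series
  Li k zero    = K.0#
  Li k (suc m) = K.zpow (⅟ (suc m)) (suc m K.× K.1#) k

  t/[e^t-1] : K[t].Series
  t/[e^t-1] = K[t].T K[t]./ (e^t K[t].- K[t].1#)

  t/[e^t-1]^ : ℤ → K[t].Series
  t/[e^t-1]^ r = K[t].zpow t/[e^t-1] (K[t].inverse t/[e^t-1]) r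

  1-e^-t : K[t].Series
  1-e^-t = K[t].1# K[t].- e^-t

  polyBernoulliSeries : ℤ → K[t].Series
  polyBernoulliSeries k = (Li k K[t].⟪ 1-e^-t ⟫) K[t]./ 1-e^-t

  mixedSeries : ℤ → ℤ → K[x][t].Series
  mixedSeries r k =
    (const ∘ (t/[e^t-1]^ r K[t].* polyBernoulliSeries k)) K[x][t].* e^xt

  B : ℕ → K.Carrier
  B n = (n !) K.× t/[e^t-1] n

  s : ℤ → ℤ → ℕ → Poly
  s r k n = (n !) K[x].× mixedSeries r k n

{-# OPTIONS --safe #-}

-- The operator θ = t d/dt multiplies the coefficient of tⁿ by n.  With
-- b = t/(eᵗ - 1), u = 1 - e⁻ᵗ and P_k = Li_k(u)/u one finds
--   θ b = (1 - t - b) b   and   θ P_k = b (P_{k-1} - P_k),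
-- the latter because u Li_k′(u) = Li_{k-1}(u) and e⁻ᵗ/u = b/t.  Hence the
-- generating function F_{r,k} = bʳ P_k eˣᵗ satisfies
--   θ F_{r,k} + r (b + t - 1) F_{r,k} + F_{r+1,k} = F_{r+1,k-1} + x t F_{r,k}.
-- Since b(-t) = b + t, the factor b + t - 1 is t/2 + Σ_{m≥2} (-1)ᵐ B_m tᵐ/m!,
-- and the theorem is the comparison of the coefficients of tⁿ.
module Submission where

open import Algebra.Bundles using (CommutativeRing; RawRing)
import Algebra.Morphism.RingMonomorphism as RingMonomorphism
open import Algebra.Morphism.Structures
  using (IsRingHomomorphism; IsRingMonomorphism)
import Algebra.Properties.CommutativeMonoid.Mult as CommutativeMonoidMult
import Algebra.Properties.Ring as RingProperties
import Algebra.Properties.Semiring.Exp as SemiringExp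
import Algebra.Properties.Semiring.Mult as SemiringMult
import Algebra.Properties.Semiring.Sum as SemiringSum
import Algebra.Solver.Ring.NaturalCoefficients.Default as NaturalSolver
open import Data.Fin.Base using (toℕ)
open import Data.Fin.Properties using (toℕ≤pred[n])
open import Data.Integer.Base as ℤ using (ℤ; 1ℤ; +_; -[1+_])
import Data.Integer.Properties as ℤ
open import Data.List.Base using ([]; _∷_; map)
open import Data.Nat.Base as ℕ
  using (ℕ; zero; suc; _≤_; _<_; _∸_; z≤n; s≤s; NonZero; _!)
open import Data.Nat.Combinatorics using (_C_; nCk≡n!/k![n-k]!; k![n∸k]!∣n!)
open import Data.Nat.DivMod using (m/n*n≡m)
import Data.Nat.Properties as ℕ
open import Data.Product.Base using (_,_)
open import Defs
open import Function.Base using (_∘_; id)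
open import Level using (Level; _⊔_)
open import Relation.Binary.PropositionalEquality as ≡ using (_≡_)
import Relation.Binary.Reasoning.Setoid as ≈-Reasoning

-- The coefficient ring may have zero divisors, so division by t or by u is always the cancellation
-- of a series of the form t times an invertible series. Each relation is multiplied out, checked as
-- a polynomial identity and then cancelled. Signs are moved across the equations because these
-- identities are normalised over commutative semirings. The main obstacle is the chain rule for
-- Li_k(u). Composition is a sum whose cut-off grows with the degree, so it is handled through the
-- Horner step f(v) = f₀ + v g(v) and an induction on the degree. The reflection b(-t) = b + t holds
-- because both sides become t when multiplied by u. In degree one it reads -b₁ = b₁ + 1, so the 1/2
-- comes without a separate computation of B₁. The product bʳ P_k is treated over the ground ring
-- and carried to K[x] by a ring homomorphism; only eˣᵗ lives over K[x] from the start.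

private
  variable
    c ℓ c′ ℓ′ : Level

-- Finite sums, multiples and integer powers in commutative rings.

module RingLemmas (R : CommutativeRing c ℓ) where
  open CommutativeRing R
  open RingNotation rawRing using (_×_; _^_; fromℤ; zpow; sumUpTo) public
  open RingProperties ring public
  open SemiringMult semiring public
    using (×-congʳ; ×1-homo-*; ×-homo-+; ×-comm-*; ×-assoc-*; ×-assocˡ)
  open CommutativeMonoidMult +-commutativeMonoid public using (×-distrib-+)
  open SemiringSum semiring
  open NaturalSolver commutativeSemiring public using (solve; _:=_; _:+_; _:*_; con)
  open ≈-Reasoning setoid

  -- Makes a multiple a product, so that `solve` can treat `n × 1#` as one variable.
  ×1-* : ∀ n x → (n × 1#) * x ≈ n × x
  ×1-* n x = trans (×-assoc-* n 1# x) (×-congʳ n (*-identityˡ x))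

  sumUpTo-cong : ∀ n (f g : ℕ → Carrier) → (∀ i → i ≤ n → f i ≈ g i) → sumUpTo n f ≈ sumUpTo n g
  sumUpTo-cong n f g f≈g = sum-cong-≋ {suc n} (λ i → f≈g (toℕ i) (toℕ≤pred[n] i))

  sumUpTo-+ : ∀ n (f g : ℕ → Carrier) → sumUpTo n (λ i → f i + g i) ≈ sumUpTo n f + sumUpTo n g
  sumUpTo-+ n f g = ∑-distrib-+ {suc n} (f ∘ toℕ) (g ∘ toℕ)

  *-distribˡ-sumUpTo : ∀ n x (f : ℕ → Carrier) → x * sumUpTo n f ≈ sumUpTo n (λ i → x * f i)
  *-distribˡ-sumUpTo n x f = *-distribˡ-sum {suc n} x (f ∘ toℕ)

  sumUpTo-comm : ∀ m n (f : ℕ → ℕ → Carrier) →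
    sumUpTo m (λ i → sumUpTo n (f i)) ≈ sumUpTo n (λ j → sumUpTo m (λ i → f i j))
  sumUpTo-comm m n f = ∑-comm {suc m} {suc n} (λ i j → f (toℕ i) (toℕ j))

  sumUpTo-suc : ∀ n (f : ℕ → Carrier) → sumUpTo (suc n) f ≈ sumUpTo n f + f (suc n)
  sumUpTo-suc zero    f = solve 2 (λ x y → x :+ (y :+ con 0) := (x :+ con 0) :+ y) refl (f 0) (f 1)
  sumUpTo-suc (suc n) f = trans (+-congˡ (sumUpTo-suc n (f ∘ suc))) (sym (+-assoc _ _ _))

  sumUpTo-zero : ∀ n (f : ℕ → Carrier) → (∀ i → f i ≈ 0#) → sumUpTo n f ≈ 0#
  sumUpTo-zero zero    f f≈0 = trans (+-identityʳ _) (f≈0 0)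
  sumUpTo-zero (suc n) f f≈0 =
    trans (+-cong (f≈0 0) (sumUpTo-zero n (f ∘ suc) (f≈0 ∘ suc))) (+-identityˡ 0#)

  -- Composition cuts its sum at the degree of the coefficient; this compares the cuts belonging to
  -- different degrees.
  sumUpTo-truncate : ∀ {m n} (f : ℕ → Carrier) → m ≤ n → (∀ i → m < i → f i ≈ 0#) →
    sumUpTo n f ≈ sumUpTo m f
  sumUpTo-truncate {n = zero}  f z≤n f≈0 = refl
  sumUpTo-truncate {n = suc n} f z≤n f≈0 =
    +-congˡ (sumUpTo-zero n (f ∘ suc) (λ i → f≈0 (suc i) (s≤s z≤n)))
  sumUpTo-truncate f (s≤s m≤n) f≈0 =
    +-congˡ (sumUpTo-truncate (f ∘ suc) m≤n (λ i m<i → f≈0 (suc i) (s≤s m<i)))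

  zpow-suc : ∀ {a b} → a * b ≈ 1# → ∀ k → zpow a b (k ℤ.+ 1ℤ) ≈ a * zpow a b k
  zpow-suc {a} {b} ab≈1 (+ n) = reflexive (≡.cong (a ^_) (ℕ.+-comm n 1))
  zpow-suc {a} {b} ab≈1 -[1+ zero ] = trans (sym ab≈1) (*-congˡ (sym (*-identityʳ b)))
  zpow-suc {a} {b} ab≈1 -[1+ suc n ] = begin
    b * b ^ n           ≈⟨ *-identityˡ _ ⟨
    1# * (b * b ^ n)    ≈⟨ *-congʳ ab≈1 ⟨
    a * b * (b * b ^ n) ≈⟨ *-assoc _ _ _ ⟩
    a * (b * (b * b ^ n)) ∎

module HomomorphismLemmas
  (R : CommutativeRing c ℓ) (S : CommutativeRing c′ ℓ′)
  {φ : CommutativeRing.Carrier R → CommutativeRing.Carrier S}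
  (φ-homo : IsRingHomomorphism (CommutativeRing.rawRing R) (CommutativeRing.rawRing S) φ)
  where
  private
    module R = CommutativeRing R
    module S = CommutativeRing S
    module RN = RingNotation R.rawRing
    module SN = RingNotation S.rawRing
  open IsRingHomomorphism φ-homo
  open S using (_≈_)

  ×-homo : ∀ n x → φ (n RN.× x) ≈ n SN.× φ x
  ×-homo zero    x = 0#-homo
  ×-homo (suc n) x = S.trans (+-homo x _) (S.+-congˡ (×-homo n x))

  ^-homo : ∀ x n → φ (x RN.^ n) ≈ φ x SN.^ n
  ^-homo x zero    = 1#-homo
  ^-homo x (suc n) = S.trans (*-homo x _) (S.*-congˡ (^-homo x n))

  ×1-homo : ∀ n → φ (n RN.× R.1#) ≈ n SN.× S.1#
  ×1-homo n = S.trans (×-homo n R.1#) (SemiringMult.×-congʳ S.semiring n 1#-homo)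

  fromℤ-homo : ∀ k → φ (RN.fromℤ k) ≈ SN.fromℤ k
  fromℤ-homo (+ n)    = ×1-homo n
  fromℤ-homo -[1+ n ] = S.trans (-‿homo _) (S.-‿cong (×1-homo (suc n)))

  sumUpTo-homo : ∀ n (f : ℕ → R.Carrier) → φ (RN.sumUpTo n f) ≈ SN.sumUpTo n (φ ∘ f)
  sumUpTo-homo zero    f = S.trans (+-homo _ _) (S.+-congˡ 0#-homo)
  sumUpTo-homo (suc n) f = S.trans (+-homo _ _) (S.+-congˡ (sumUpTo-homo n (f ∘ suc)))

-- The commutative ring of formal power series.

module SeriesLemmas (R : CommutativeRing c ℓ) where
  open CommutativeRing R
  open RingLemmas R
  open PowerSeries rawRing using (Series; scalar; seriesRing; T; divT)
  private module S = PowerSeries rawRing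
  open ≈-Reasoning setoid

  scalar-0 : ∀ n → scalar 0# n ≈ 0#
  scalar-0 zero    = refl
  scalar-0 (suc n) = refl

  *-congₛ : ∀ {f f′ g g′} → f S.≈ f′ → g S.≈ g′ → (f S.* g) S.≈ (f′ S.* g′)
  *-congₛ f≈f′ g≈g′ n = sumUpTo-cong n _ _ (λ i _ → *-cong (f≈f′ i) (g≈g′ (n ∸ i)))

  -- The convolution unfolds definitionally at the constant term of f. This peels off its other end,
  -- and with both ends available commutativity is an induction on n.
  *-sucʳ : ∀ f g n → (f S.* g) (suc n) ≈ (f S.* divT g) n + f (suc n) * g 0
  *-sucʳ f g zero = solve 2 (λ x y → x :+ (y :+ con 0) := (x :+ con 0) :+ y) refl _ _
  *-sucʳ f g (suc n) = trans (+-congˡ (*-sucʳ (divT f) g n)) (sym (+-assoc _ _ _))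

  *-commₛ : ∀ f g → (f S.* g) S.≈ (g S.* f)
  *-commₛ f g zero    = +-congʳ (*-comm _ _)
  *-commₛ f g (suc n) = begin
    f 0 * g (suc n) + (divT f S.* g) n ≈⟨ +-cong (*-comm _ _) (*-commₛ (divT f) g n) ⟩
    g (suc n) * f 0 + (g S.* divT f) n ≈⟨ +-comm _ _ ⟩
    (g S.* divT f) n + g (suc n) * f 0 ≈⟨ *-sucʳ g f n ⟨
    (g S.* f) (suc n)                  ∎

  *-distribʳₛ : ∀ h f g → ((f S.+ g) S.* h) S.≈ ((f S.* h) S.+ (g S.* h))
  *-distribʳₛ h f g n =
    trans (sumUpTo-cong n _ (λ i → f i * h (n ∸ i) + g i * h (n ∸ i))
            (λ i _ → distribʳ (h (n ∸ i)) (f i) (g i)))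
          (sumUpTo-+ n (λ i → f i * h (n ∸ i)) (λ i → g i * h (n ∸ i)))

  *-distribˡₛ : ∀ f g h → (f S.* (g S.+ h)) S.≈ ((f S.* g) S.+ (f S.* h))
  *-distribˡₛ f g h n =
    trans (sumUpTo-cong n _ (λ i → f i * g (n ∸ i) + f i * h (n ∸ i))
            (λ i _ → distribˡ (f i) (g (n ∸ i)) (h (n ∸ i))))
          (sumUpTo-+ n (λ i → f i * g (n ∸ i)) (λ i → f i * h (n ∸ i)))

  scale-* : ∀ a f g n → ((λ i → a * f i) S.* g) n ≈ a * (f S.* g) n
  scale-* a f g n =
    trans (sumUpTo-cong n _ (λ i → a * (f i * g (n ∸ i))) (λ i _ → *-assoc a (f i) (g (n ∸ i))))
          (sym (*-distribˡ-sumUpTo n a (λ i → f i * g (n ∸ i))))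

  -- Induction on the degree with f varying: once `f 0` is split off, what remains is the same law
  -- for `divT f`, one degree lower.
  *-assocₛ : ∀ f g h → ((f S.* g) S.* h) S.≈ (f S.* (g S.* h))
  *-assocₛ f g h zero =
    solve 3 (λ x y z → (x :* y :+ con 0) :* z :+ con 0 := x :* (y :* z :+ con 0) :+ con 0)
      refl (f 0) (g 0) (h 0)
  *-assocₛ f g h (suc n) = begin
    (f 0 * g 0 + 0#) * h (suc n) + (((λ i → f 0 * divT g i) S.+ (divT f S.* g)) S.* h) n
      ≈⟨ +-cong (*-congʳ (+-identityʳ _)) (trans (*-distribʳₛ h (λ i → f 0 * divT g i) (divT f S.* g) n)
           (+-cong (scale-* (f 0) (divT g) h n) (*-assocₛ (divT f) g h n))) ⟩
    (f 0 * g 0) * h (suc n) + (f 0 * (divT g S.* h) n + (divT f S.* (g S.* h)) n)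
      ≈⟨ solve 5 (λ a b c d e → (a :* b) :* c :+ (a :* d :+ e) := a :* (b :* c :+ d) :+ e)
           refl (f 0) (g 0) (h (suc n)) _ _ ⟩
    f 0 * (g 0 * h (suc n) + (divT g S.* h) n) + (divT f S.* (g S.* h)) n ∎

  scalar-*ₛ : ∀ a f n → (scalar a S.* f) n ≈ a * f n
  scalar-*ₛ a f zero    = +-identityʳ _
  scalar-*ₛ a f (suc n) =
    trans (+-congˡ (sumUpTo-zero n _ (λ i → zeroˡ (f (n ∸ i))))) (+-identityʳ _)

  *-identityˡₛ : ∀ f → (S.1# S.* f) S.≈ f
  *-identityˡₛ f n = trans (scalar-*ₛ 1# f n) (*-identityˡ _)

  seriesCommutativeRing : CommutativeRing c ℓ
  seriesCommutativeRing = record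
    { RawRing seriesRing
    ; isCommutativeRing = record
      { isRing = record
        { +-isAbelianGroup = record
          { isGroup = record
            { isMonoid = record
              { isSemigroup = record
                { isMagma = record
                  { isEquivalence = record
                    { refl  = λ n → refl
                    ; sym   = λ f≈g n → sym (f≈g n)
                    ; trans = λ f≈g g≈h n → trans (f≈g n) (g≈h n)
                    }
                  ; ∙-cong = λ f≈f′ g≈g′ n → +-cong (f≈f′ n) (g≈g′ n)
                  }
                ; assoc = λ f g h n → +-assoc _ _ _
                }
              ; identity = (λ f n → trans (+-congʳ (scalar-0 n)) (+-identityˡ _))
                         , (λ f n → trans (+-congˡ (scalar-0 n)) (+-identityʳ _))
              }
            ; inverse = (λ f n → trans (-‿inverseˡ _) (sym (scalar-0 n)))
                      , (λ f n → trans (-‿inverseʳ _) (sym (scalar-0 n)))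
            ; ⁻¹-cong = λ f≈g n → -‿cong (f≈g n)
            }
          ; comm = λ f g n → +-comm _ _
          }
        ; *-cong     = *-congₛ
        ; *-assoc    = *-assocₛ
        ; *-identity = *-identityˡₛ
                     , (λ f n → trans (*-commₛ f S.1# n) (*-identityˡₛ f n))
        ; distrib    = *-distribˡₛ , *-distribʳₛ
        }
      ; *-comm = *-commₛ
      }
    }

  scalar-isRingHomomorphism : IsRingHomomorphism rawRing seriesRing scalar
  scalar-isRingHomomorphism = record
    { isSemiringHomomorphism = record
      { isNearSemiringHomomorphism = record
        { +-isMonoidHomomorphism = record
          { isMagmaHomomorphism = record
            { isRelHomomorphism = record
              { cong = λ { a≈b zero → a≈b ; a≈b (suc n) → refl } }
            ; homo = λ { a b zero → refl ; a b (suc n) → sym (+-identityˡ 0#) }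
            }
          ; ε-homo = λ n → refl
          }
        ; *-homo = λ { a b zero → sym (+-identityʳ _)
                     ; a b (suc n) → sym (trans (scalar-*ₛ a (scalar b) (suc n)) (zeroʳ a)) }
        }
      ; 1#-homo = λ n → refl
      }
    ; -‿homo = λ { a zero → refl ; a (suc n) → sym -0#≈0# }
    }

  T*-zero : ∀ f → (T S.* f) 0 ≈ 0#
  T*-zero f = trans (+-identityʳ _) (zeroˡ _)

  T*-suc : ∀ f n → (T S.* f) (suc n) ≈ f n
  T*-suc f n = begin
    0# * f (suc n) + (divT T S.* f) n ≈⟨ +-cong (zeroˡ _) (*-congₛ {g = f} divT-T (λ _ → refl) n) ⟩
    0# + (S.1# S.* f) n               ≈⟨ +-identityˡ _ ⟩
    (S.1# S.* f) n                    ≈⟨ *-identityˡₛ f n ⟩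
    f n                               ∎
    where
    divT-T : divT T S.≈ S.1#
    divT-T zero    = refl
    divT-T (suc n) = refl

-- The polynomial ring.

module PolynomialLemmas (R : CommutativeRing c ℓ) where
  open CommutativeRing R
  open RingLemmas R
  open SeriesLemmas R
  open Polynomial rawRing
  open PowerSeries rawRing using (seriesRing; scalar)
  private module S = PowerSeries rawRing
  open ≈-Reasoning setoid

  coeff-add : ∀ p q n → coeff (add p q) n ≈ coeff p n + coeff q n
  coeff-add []      q       n       = sym (+-identityˡ _)
  coeff-add (a ∷ p) []      n       = sym (+-identityʳ _)
  coeff-add (a ∷ p) (b ∷ q) zero    = refl
  coeff-add (a ∷ p) (b ∷ q) (suc n) = coeff-add p q n

  coeff-map : ∀ f → f 0# ≈ 0# → ∀ p n → coeff (map f p) n ≈ f (coeff p n)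
  coeff-map f f0≈0 []      n       = sym f0≈0
  coeff-map f f0≈0 (a ∷ p) zero    = refl
  coeff-map f f0≈0 (a ∷ p) (suc n) = coeff-map f f0≈0 p n

  coeff-mul : ∀ p q → coeff (mul p q) S.≈ (coeff p S.* coeff q)
  coeff-mul []      q n = sym (sumUpTo-zero n _ (λ i → zeroˡ (coeff q (n ∸ i))))
  coeff-mul (a ∷ p) q n = trans (coeff-add (map (a *_) q) (0# ∷ mul p q) n)
    (trans (+-congʳ (coeff-map (a *_) (zeroʳ a) q n)) (tail n))
    where
    tail : ∀ n → a * coeff q n + coeff (0# ∷ mul p q) n ≈ (coeff (a ∷ p) S.* coeff q) n
    tail zero    = refl
    tail (suc n) = +-congˡ (coeff-mul p q n)

  coeff-const : ∀ a → coeff (const a) S.≈ scalar a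
  coeff-const a zero    = refl
  coeff-const a (suc n) = refl

  -- Equality of polynomials is by definition equality of coefficients, so injectivity is `id` and
  -- the ring laws of series can be pulled back to lists.
  coeff-isRingMonomorphism : IsRingMonomorphism polyRing seriesRing coeff
  coeff-isRingMonomorphism = record
    { isRingHomomorphism = record
      { isSemiringHomomorphism = record
        { isNearSemiringHomomorphism = record
          { +-isMonoidHomomorphism = record
            { isMagmaHomomorphism = record
              { isRelHomomorphism = record { cong = id }
              ; homo = coeff-add
              }
            ; ε-homo = λ n → sym (scalar-0 n)
            }
          ; *-homo = coeff-mul
          }
        ; 1#-homo = coeff-const 1#
        }
      ; -‿homo = coeff-map -_ -0#≈0#
      }
    ; injective = id
    }

  polyCommutativeRing : CommutativeRing c ℓ
  polyCommutativeRing = record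
    { RawRing polyRing
    ; isCommutativeRing = RingMonomorphism.isCommutativeRing coeff-isRingMonomorphism
        (CommutativeRing.isCommutativeRing seriesCommutativeRing)
    }

  const-isRingHomomorphism : IsRingHomomorphism rawRing polyRing const
  const-isRingHomomorphism = record
    { isSemiringHomomorphism = record
      { isNearSemiringHomomorphism = record
        { +-isMonoidHomomorphism = record
          { isMagmaHomomorphism = record
            { isRelHomomorphism = record
              { cong = λ { a≈b zero → a≈b ; a≈b (suc n) → refl } }
            ; homo = λ a b n → refl
            }
          ; ε-homo = λ { zero → refl ; (suc n) → refl }
          }
        ; *-homo = λ { a b zero → sym (+-identityʳ _) ; a b (suc n) → refl }
        }
      ; 1#-homo = λ n → refl
      }
    ; -‿homo = λ a n → refl
    }

-- Derivations and logarithmic derivatives.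

record IsDerivation (R : CommutativeRing c ℓ)
    (θ : CommutativeRing.Carrier R → CommutativeRing.Carrier R) : Set (c ⊔ ℓ) where
  open CommutativeRing R
  field
    θ-cong : ∀ {x y} → x ≈ y → θ x ≈ θ y
    θ-+    : ∀ x y → θ (x + y) ≈ θ x + θ y
    θ-*    : ∀ x y → θ (x * y) ≈ θ x * y + x * θ y

module DerivationLemmas (R : CommutativeRing c ℓ)
    {θ : CommutativeRing.Carrier R → CommutativeRing.Carrier R} (isDerivation : IsDerivation R θ)
  where
  open CommutativeRing R
  open RingLemmas R
  open IsDerivation isDerivation public
  open ≈-Reasoning setoid

  θ-1 : θ 1# ≈ 0#
  θ-1 = x+x≈x⇒x≈0 (θ 1#) (begin
    θ 1# + θ 1#           ≈⟨ +-cong (*-identityʳ _) (*-identityˡ _) ⟨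
    θ 1# * 1# + 1# * θ 1# ≈⟨ θ-* 1# 1# ⟨
    θ (1# * 1#)           ≈⟨ θ-cong (*-identityˡ 1#) ⟩
    θ 1#                  ∎)

  module _ {a d : Carrier} (θa≈da : θ a ≈ d * a) where

    -- Here `d` plays the part of θa / a, stated multiplicatively so that a itself need not be
    -- invertible.
    θ-^ : ∀ n → θ (a ^ n) ≈ (n × 1#) * d * a ^ n
    θ-^ zero    = begin
      θ 1#          ≈⟨ θ-1 ⟩
      0#            ≈⟨ solve 1 (λ d → con 0 := con 0 :* d :* con 1) refl d ⟩
      0# * d * 1#   ∎
    θ-^ (suc n) = begin
      θ (a * a ^ n)                                  ≈⟨ θ-* a (a ^ n) ⟩
      θ a * a ^ n + a * θ (a ^ n)                    ≈⟨ +-cong (*-congʳ θa≈da) (*-congˡ (θ-^ n)) ⟩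
      d * a * a ^ n + a * ((n × 1#) * d * a ^ n)
        ≈⟨ solve 4 (λ d a p m → d :* a :* p :+ a :* (m :* d :* p) := (con 1 :+ m) :* d :* (a :* p))
             refl d a (a ^ n) (n × 1#) ⟩
      (1# + (n × 1#)) * d * (a * a ^ n)              ∎

    -- Apply θ to ab = 1 and multiply by b: the factors ab collapse and leave θb + db = 0.
    θ-inverse : ∀ {b} → a * b ≈ 1# → θ b ≈ - d * b
    θ-inverse {b} ab≈1 = trans (+-inverseˡ-unique (θ b) (d * b) θb+db≈0) (-‿distribˡ-* d b)
      where
      θb+db≈0 : θ b + d * b ≈ 0#
      θb+db≈0 = begin
        θ b + d * b                         ≈⟨ +-cong (*-identityˡ _) (*-identityˡ _) ⟨
        1# * θ b + 1# * (d * b)             ≈⟨ +-cong (*-congʳ ab≈1) (*-congʳ ab≈1) ⟨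
        a * b * θ b + a * b * (d * b)
          ≈⟨ solve 4 (λ a b x d → a :* b :* x :+ a :* b :* (d :* b) := b :* (d :* a :* b :+ a :* x))
               refl a b (θ b) d ⟩
        b * (d * a * b + a * θ b)           ≈⟨ *-congˡ (+-congʳ (*-congʳ θa≈da)) ⟨
        b * (θ a * b + a * θ b)             ≈⟨ *-congˡ (θ-* a b) ⟨
        b * θ (a * b)                       ≈⟨ *-congˡ (trans (θ-cong ab≈1) θ-1) ⟩
        b * 0#                              ≈⟨ zeroʳ b ⟩
        0#                                  ∎

  θ-zpow : ∀ {a b d} → a * b ≈ 1# → θ a ≈ d * a → ∀ k →
           θ (zpow a b k) ≈ fromℤ k * d * zpow a b k
  θ-zpow ab≈1 θa≈da (+ n) = θ-^ θa≈da n
  θ-zpow {a} {b} {d} ab≈1 θa≈da -[1+ n ] = begin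
    θ (b ^ suc n)                      ≈⟨ θ-^ (θ-inverse θa≈da ab≈1) (suc n) ⟩
    (suc n × 1#) * - d * b ^ suc n     ≈⟨ *-congʳ (-‿distribʳ-* _ d) ⟨
    - ((suc n × 1#) * d) * b ^ suc n   ≈⟨ *-congʳ (-‿distribˡ-* _ d) ⟩
    - (suc n × 1#) * d * b ^ suc n     ∎

-- The Euler derivation θ on power series.

module EulerDerivation (R : CommutativeRing c ℓ) where
  open CommutativeRing R
  open RingLemmas R
  open SeriesLemmas R
  open PowerSeries rawRing using (Series; scalar; T; divT; _⟪_⟫; inverse)
  private
    module S  = PowerSeries rawRing
    module SR = CommutativeRing seriesCommutativeRing
    module SL = RingLemmas seriesCommutativeRing

  θ : Series → Series
  θ f n = n × f n

  θ-isDerivation : IsDerivation seriesCommutativeRing θ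
  θ-isDerivation = record
    { θ-cong = λ f≈g n → ×-congʳ n (f≈g n)
    ; θ-+    = λ f g n → ×-distrib-+ (f n) (g n) n
    ; θ-*    = leibniz
    }
    where
    open ≈-Reasoning setoid
    -- The weight n of a convolution term is the sum of the weights of its factors. The equation is
    -- a hypothesis so that it can be matched with `refl` before j becomes `n ∸ i`.
    split : ∀ {i j n} → i ℕ.+ j ≡ n → ∀ x y →
            (n × 1#) * (x * y) ≈ (i × x) * y + x * (j × y)
    split {i} {j} ≡.refl x y = begin
      ((i ℕ.+ j) × 1#) * (x * y)       ≈⟨ ×1-* (i ℕ.+ j) (x * y) ⟩
      (i ℕ.+ j) × (x * y)              ≈⟨ ×-homo-+ (x * y) i j ⟩
      i × (x * y) + j × (x * y)        ≈⟨ +-cong (×-assoc-* i x y) (×-comm-* j x y) ⟨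
      (i × x) * y + x * (j × y)        ∎

    leibniz : ∀ f g → θ (f S.* g) S.≈ ((θ f S.* g) S.+ (f S.* θ g))
    leibniz f g n = begin
      n × (f S.* g) n           ≈⟨ ×1-* n _ ⟨
      (n × 1#) * (f S.* g) n    ≈⟨ *-distribˡ-sumUpTo n (n × 1#) (λ i → f i * g (n ∸ i)) ⟩
      sumUpTo n (λ i → (n × 1#) * (f i * g (n ∸ i)))
        ≈⟨ sumUpTo-cong n _ (λ i → θ f i * g (n ∸ i) + f i * θ g (n ∸ i))
             (λ i i≤n → split {i} {n ∸ i} (ℕ.m+[n∸m]≡n i≤n) (f i) (g (n ∸ i))) ⟩
      sumUpTo n (λ i → θ f i * g (n ∸ i) + f i * θ g (n ∸ i))
        ≈⟨ sumUpTo-+ n (λ i → θ f i * g (n ∸ i)) (λ i → f i * θ g (n ∸ i)) ⟩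
      (θ f S.* g) n + (f S.* θ g) n ∎

  open DerivationLemmas seriesCommutativeRing θ-isDerivation public

  -- Composition of series and the chain rule.

  ⟪⟫-cong : ∀ {f g} v → f S.≈ g → (f ⟪ v ⟫) S.≈ (g ⟪ v ⟫)
  ⟪⟫-cong v f≈g n = sumUpTo-cong n _ _ (λ m _ → *-congʳ {x = (v S.^ m) n} (f≈g m))

  module _ {v : Series} (v₀≈0 : v 0 ≈ 0#) where

    *-sucˡ : ∀ f n → (v S.* f) (suc n) ≈ (divT v S.* f) n
    *-sucˡ f n = trans (+-congʳ (trans (*-congʳ v₀≈0) (zeroˡ _))) (+-identityˡ _)

    *-zero : ∀ f → (v S.* f) 0 ≈ 0#
    *-zero f = trans (+-identityʳ _) (trans (*-congʳ v₀≈0) (zeroˡ _))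

    -- Since v has no constant term, multiplication by v delays f by at least one degree; this
    -- drives the induction for the chain rule.
    *-cong-below : ∀ f g n → (∀ i → i < n → f i ≈ g i) → (v S.* f) n ≈ (v S.* g) n
    *-cong-below f g zero    f≈g = trans (*-zero f) (sym (*-zero g))
    *-cong-below f g (suc n) f≈g = trans (*-sucˡ f n) (trans
      (sumUpTo-cong n _ _ (λ i _ → *-congˡ {x = v (suc i)} (f≈g (n ∸ i) (s≤s (ℕ.m∸n≤m n i)))))
      (sym (*-sucˡ g n)))

    ^-vanishes : ∀ {n m} → n < m → (v S.^ m) n ≈ 0#
    ^-vanishes {zero}  {suc m} _         = *-zero (v S.^ m)
    ^-vanishes {suc n} {suc m} (s≤s n<m) = trans (*-sucˡ (v S.^ m) n) (sumUpTo-zero n _ (λ i →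
      trans (*-congˡ {x = v (suc i)} (^-vanishes (ℕ.≤-trans (s≤s (ℕ.m∸n≤m n i)) n<m))) (zeroʳ (v (suc i)))))

    ⟪⟫-unfold : ∀ f → (f ⟪ v ⟫) S.≈ (scalar (f 0) S.+ (v S.* (divT f ⟪ v ⟫)))
    ⟪⟫-unfold f zero = +-cong (*-identityʳ _) (sym (*-zero (divT f ⟪ v ⟫)))
    ⟪⟫-unfold f (suc n) = begin
      f 0 * 0# + sumUpTo n (λ m → f (suc m) * (v S.* (v S.^ m)) (suc n))
        ≈⟨ +-cong (zeroʳ _) (sumUpTo-cong n _ _ (λ m _ → trans
             (*-congˡ (*-sucˡ (v S.^ m) n))
             (*-distribˡ-sumUpTo n (f (suc m)) (λ i → v (suc i) * (v S.^ m) (n ∸ i))))) ⟩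
      0# + sumUpTo n (λ m → sumUpTo n (λ i → f (suc m) * (v (suc i) * (v S.^ m) (n ∸ i))))
        ≈⟨ +-congˡ (sumUpTo-comm n n (λ m i → f (suc m) * (v (suc i) * (v S.^ m) (n ∸ i)))) ⟩
      0# + sumUpTo n (λ i → sumUpTo n (λ m → f (suc m) * (v (suc i) * (v S.^ m) (n ∸ i))))
        ≈⟨ +-congˡ (sumUpTo-cong n _ _ (λ i _ → inner i)) ⟩
      0# + (divT v S.* (divT f ⟪ v ⟫)) n
        ≈⟨ +-congˡ (*-sucˡ (divT f ⟪ v ⟫) n) ⟨
      0# + (v S.* (divT f ⟪ v ⟫)) (suc n) ∎
      where
      open ≈-Reasoning setoid
      inner : ∀ i → sumUpTo n (λ m → f (suc m) * (v (suc i) * (v S.^ m) (n ∸ i)))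
                  ≈ v (suc i) * (divT f ⟪ v ⟫) (n ∸ i)
      inner i = begin
        sumUpTo n (λ m → f (suc m) * (v (suc i) * (v S.^ m) (n ∸ i)))
          ≈⟨ sumUpTo-cong n _ _ (λ m _ → solve 3 (λ x y z → x :* (y :* z) := y :* (x :* z))
               refl (f (suc m)) (v (suc i)) ((v S.^ m) (n ∸ i))) ⟩
        sumUpTo n (λ m → v (suc i) * (f (suc m) * (v S.^ m) (n ∸ i)))
          ≈⟨ *-distribˡ-sumUpTo n (v (suc i)) (λ m → f (suc m) * (v S.^ m) (n ∸ i)) ⟨
        v (suc i) * sumUpTo n (λ m → f (suc m) * (v S.^ m) (n ∸ i))
          -- The sum over m is still cut at n, while composition in degree `n ∸ i` cuts at `n ∸ i`;
          -- the surplus powers of v vanish in that degree.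
          ≈⟨ *-congˡ (sumUpTo-truncate (λ m → f (suc m) * (v S.^ m) (n ∸ i)) (ℕ.m∸n≤m n i)
               (λ m n∸i<m → trans (*-congˡ (^-vanishes n∸i<m)) (zeroʳ _))) ⟩
        v (suc i) * (divT f ⟪ v ⟫) (n ∸ i) ∎

    private
      -- Unfolding f⟪v⟫ = f₀ + v (divT f)⟪v⟫ turns θ into θ + 1 on divT f, so the
      -- induction needs the weights j + n instead of n.
      weighted : ℕ → Series → Series
      weighted j f n = (j ℕ.+ n) × f n

      θ-scalar : ∀ a → θ (scalar a) S.≈ S.0#
      θ-scalar a zero    = refl
      θ-scalar a (suc n) = trans (sym (×1-* (suc n) 0#)) (zeroʳ _)

      _×ₛ1 : ℕ → Series
      j ×ₛ1 = j SL.× S.1#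

      -- Heuristically `lhs j f` is v¹⁻ʲ θ(vʲ f(v)), and `rhs j f` is what the chain rule for xʲ
      -- f(x) predicts for it. The powers of v are divided out in advance.
      lhs rhs : ℕ → Series → Series
      lhs j f = (v S.* θ (f ⟪ v ⟫)) S.+ (j ×ₛ1 S.* (f ⟪ v ⟫) S.* θ v)
      rhs j f = (weighted j f ⟪ v ⟫) S.* θ v

      -- Both `lhs` and `rhs` obey this recursion with the same inhomogeneous term. On this side the
      -- Leibniz term v g θv is what raises j by one.
      lhs-unfold : ∀ j f →
        lhs j f S.≈ ((v S.* lhs (suc j) (divT f)) S.+ (j ×ₛ1 S.* scalar (f 0) S.* θ v))
      lhs-unfold j f = begin
        lhs j f
          ≈⟨ SR.+-cong
               (SR.*-congˡ {x = v} (SR.trans (θ-cong (⟪⟫-unfold f)) (SR.trans (θ-+ a (v S.* g))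
                 (SR.+-cong (θ-scalar (f 0)) (θ-* v g)))))
               (SR.*-congʳ {x = θ v} (SR.*-congˡ {x = j ×ₛ1} (⟪⟫-unfold f))) ⟩
        (v S.* (S.0# S.+ ((θ v S.* g) S.+ (v S.* θ g)))) S.+ (j ×ₛ1 S.* (a S.+ (v S.* g)) S.* θ v)
          ≈⟨ SL.solve 6 (λ v dv g dg a j →
               v SL.:* (SL.con 0 SL.:+ (dv SL.:* g SL.:+ v SL.:* dg))
                 SL.:+ j SL.:* (a SL.:+ v SL.:* g) SL.:* dv
               SL.:= v SL.:* (v SL.:* dg SL.:+ (SL.con 1 SL.:+ j) SL.:* g SL.:* dv)
                 SL.:+ j SL.:* a SL.:* dv)
               SR.refl v (θ v) g (θ g) a (j ×ₛ1) ⟩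
        (v S.* lhs (suc j) (divT f)) S.+ (j ×ₛ1 S.* a S.* θ v) ∎
        where
        open ≈-Reasoning SR.setoid
        a = scalar (f 0)
        g = divT f ⟪ v ⟫

      scalar-× : ∀ j a → scalar ((j ℕ.+ 0) × a) S.≈ (j ×ₛ1 S.* scalar a)
      scalar-× j a = begin
        scalar ((j ℕ.+ 0) × a)  ≈⟨ SR.reflexive (≡.cong (λ k → scalar (k × a)) (ℕ.+-identityʳ j)) ⟩
        scalar (j × a)          ≈⟨ ×-homo j a ⟩
        j SL.× scalar a         ≈⟨ SL.×1-* j (scalar a) ⟨
        j ×ₛ1 S.* scalar a      ∎
        where
        open ≈-Reasoning SR.setoid
        open HomomorphismLemmas R seriesCommutativeRing scalar-isRingHomomorphism

      rhs-unfold : ∀ j f →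
        rhs j f S.≈ ((v S.* rhs (suc j) (divT f)) S.+ (j ×ₛ1 S.* scalar (f 0) S.* θ v))
      rhs-unfold j f = begin
        rhs j f
          ≈⟨ SR.*-congʳ {x = θ v} (SR.trans (⟪⟫-unfold (weighted j f))
               (SR.+-cong (scalar-× j (f 0)) (SR.*-congˡ {x = v} (⟪⟫-cong v
                 (λ n → reflexive (≡.cong (_× f (suc n)) (ℕ.+-suc j n))))))) ⟩
        ((j ×ₛ1 S.* scalar (f 0)) S.+ (v S.* g)) S.* θ v
          ≈⟨ SL.solve 4 (λ v dv g a →
               (a SL.:+ v SL.:* g) SL.:* dv SL.:= v SL.:* (g SL.:* dv) SL.:+ a SL.:* dv)
               SR.refl v (θ v) g (j ×ₛ1 S.* scalar (f 0)) ⟩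
        (v S.* rhs (suc j) (divT f)) S.+ (j ×ₛ1 S.* scalar (f 0) S.* θ v) ∎
        where
        open ≈-Reasoning SR.setoid
        g = weighted (suc j) (divT f) ⟪ v ⟫

      -- Strong induction on the degree n with bound N. Both j and f vary, since the recursion
      -- passes to `suc j` and `divT f`, and its factor v asks only for degrees below n.
      lhs≈rhs : ∀ N n → n < N → ∀ j f → lhs j f n ≈ rhs j f n
      lhs≈rhs (suc N) n (s≤s n≤N) j f = begin
        lhs j f n   ≈⟨ lhs-unfold j f n ⟩
        (v S.* lhs (suc j) (divT f)) n + a
          ≈⟨ +-congʳ (*-cong-below (lhs (suc j) (divT f)) (rhs (suc j) (divT f)) n
               (λ i i<n → lhs≈rhs N i (ℕ.≤-trans i<n n≤N) (suc j) (divT f))) ⟩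
        (v S.* rhs (suc j) (divT f)) n + a ≈⟨ rhs-unfold j f n ⟨
        rhs j f n   ∎
        where
        open ≈-Reasoning setoid
        a = (j ×ₛ1 S.* scalar (f 0) S.* θ v) n

    -- The chain rule multiplied by v, which turns f′(v) into (θf)(v) and so avoids the ordinary
    -- derivative. It is the weight j = 0.
    θ-⟪⟫ : ∀ f → (v S.* θ (f ⟪ v ⟫)) S.≈ ((θ f ⟪ v ⟫) S.* θ v)
    θ-⟪⟫ f = begin
      v S.* θ (f ⟪ v ⟫)
        ≈⟨ SL.solve 3 (λ x y z → x SL.:= x SL.:+ SL.con 0 SL.:* y SL.:* z)
             SR.refl (v S.* θ (f ⟪ v ⟫)) (f ⟪ v ⟫) (θ v) ⟩
      lhs 0 f  ≈⟨ (λ n → lhs≈rhs (suc n) n ℕ.≤-refl 0 f) ⟩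
      rhs 0 f  ∎
      where open ≈-Reasoning SR.setoid

  -- Inverses, quotients and cancellation of series.

  inverse-inverseʳ : ∀ {f} → f 0 ≈ 1# → (f S.* inverse f) S.≈ S.1#
  inverse-inverseʳ {f} f₀≈1 = SL.+-cancelʳ (v S.* g) (f S.* g) S.1# (begin
    (f S.* g) S.+ (v S.* g)  ≈⟨ SR.distribʳ g f v ⟨
    (f S.+ v) S.* g          ≈⟨ SR.*-congʳ {x = g} f+v≈1 ⟩
    S.1# S.* g               ≈⟨ SR.*-identityˡ g ⟩
    -- The constant coefficient sequence is fixed by `divT`, so one Horner step gives the geometric
    -- equation g = 1 + v g.
    g                        ≈⟨ ⟪⟫-unfold {v} v₀≈0 (λ _ → 1#) ⟩
    S.1# S.+ (v S.* g)       ∎)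
    where
    open ≈-Reasoning SR.setoid
    v = S.1# S.- f
    g = inverse f
    v₀≈0 : v 0 ≈ 0#
    v₀≈0 = trans (+-congˡ (-‿cong f₀≈1)) (-‿inverseʳ 1#)
    f+v≈1 : (f S.+ v) S.≈ S.1#
    f+v≈1 = SR.trans (SR.+-comm f v) (SR.trans (SR.+-assoc S.1# (S.- f) f)
      (SR.trans (SR.+-congˡ {x = S.1#} (SR.-‿inverseˡ f)) (SR.+-identityʳ S.1#)))

  T*-cancelˡ : ∀ f g → (T S.* f) S.≈ (T S.* g) → f S.≈ g
  T*-cancelˡ f g Tf≈Tg n = trans (sym (T*-suc f n)) (trans (Tf≈Tg (suc n)) (T*-suc g n))

  T*-divT : ∀ {f} → f 0 ≈ 0# → (T S.* divT f) S.≈ f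
  T*-divT {f} f₀≈0 zero    = trans (T*-zero (divT f)) (sym f₀≈0)
  T*-divT {f} f₀≈0 (suc n) = T*-suc (divT f) n

  module _ {g : Series} (g₀≈0 : g 0 ≈ 0#) (g₁≈1 : g 1 ≈ 1#) where

    /-* : ∀ {f} → f 0 ≈ 0# → ((f S./ g) S.* g) S.≈ f
    /-* {f} f₀≈0 = begin
      divT f S.* inverse (divT g) S.* g   ≈⟨ SR.*-congˡ {x = f S./ g} (T*-divT g₀≈0) ⟨
      divT f S.* inverse (divT g) S.* (T S.* divT g)
        -- The factor t recovered from g is handed to `divT f`, which leaves `divT g` next to its
        -- inverse.
        ≈⟨ SL.solve 4 (λ f i t g → f SL.:* i SL.:* (t SL.:* g) SL.:= (t SL.:* f) SL.:* (g SL.:* i))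
             SR.refl (divT f) (inverse (divT g)) T (divT g) ⟩
      T S.* divT f S.* (divT g S.* inverse (divT g))
        ≈⟨ SR.*-cong {x = T S.* divT f} {y = f} (T*-divT f₀≈0) (inverse-inverseʳ g₁≈1) ⟩
      f S.* S.1#                          ≈⟨ SR.*-identityʳ f ⟩
      f                                   ∎
      where open ≈-Reasoning SR.setoid

    -- g is t times the invertible series `divT g`, and both factors cancel even when the
    -- coefficients have zero divisors.
    order1-*-cancelˡ : ∀ x y → (g S.* x) S.≈ (g S.* y) → x S.≈ y
    order1-*-cancelˡ x y gx≈gy = begin
      x                 ≈⟨ undo x ⟨
      i S.* (d S.* x)   ≈⟨ SR.*-congˡ {x = i} (T*-cancelˡ (d S.* x) (d S.* y)
                             (SR.trans (SR.sym (factor x)) (SR.trans gx≈gy (factor y)))) ⟩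
      i S.* (d S.* y)   ≈⟨ undo y ⟩
      y                 ∎
      where
      open ≈-Reasoning SR.setoid
      d = divT g
      i = inverse d
      factor : ∀ z → (g S.* z) S.≈ (T S.* (d S.* z))
      factor z = SR.trans
        (SR.*-congʳ {x = z} (SR.sym {x = T S.* d} {y = g} (T*-divT g₀≈0))) (SR.*-assoc T d z)
      undo : ∀ z → (i S.* (d S.* z)) S.≈ z
      undo z = SR.trans
        (SL.solve 3 (λ i d z → i SL.:* (d SL.:* z) SL.:= (d SL.:* i) SL.:* z) SR.refl i d z)
        (SR.trans (SR.*-congʳ {x = z} (inverse-inverseʳ g₁≈1)) (SR.*-identityˡ z))

-- Reciprocals of integers and exponential series.

module ℚAlgebraLemmas (K : CommutativeℚAlgebra c ℓ) where
  open CommutativeℚAlgebra K hiding (_×_)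
  open RingLemmas commutativeRing
  open EulerDerivation commutativeRing
  open SeriesLemmas commutativeRing
  open PowerSeries rawRing using (scalar; T)
  open Exponential rawRing ⅟
  private
    module S  = PowerSeries rawRing
    module SR = CommutativeRing seriesCommutativeRing
    module SL = RingLemmas seriesCommutativeRing

  ⅟-unique : ∀ n .{{_ : NonZero n}} {x} → (n × 1#) * x ≈ 1# → x ≈ ⅟ n
  ⅟-unique n {x} nx≈1 = begin
    x                        ≈⟨ *-identityʳ x ⟨
    x * 1#                   ≈⟨ *-congˡ (⅟-inverse n) ⟨
    x * ((n × 1#) * ⅟ n)     ≈⟨ solve 3 (λ x m i → x :* (m :* i) := (m :* x) :* i) refl x (n × 1#) (⅟ n) ⟩
    (n × 1#) * x * ⅟ n       ≈⟨ *-congʳ nx≈1 ⟩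
    1# * ⅟ n                 ≈⟨ *-identityˡ _ ⟩
    ⅟ n                      ∎
    where open ≈-Reasoning setoid

  ⅟1≈1 : ⅟ 1 ≈ 1#
  ⅟1≈1 = sym (⅟-unique 1 (trans (*-identityʳ _) (+-identityʳ _)))

  ×-cancelˡ : ∀ n .{{_ : NonZero n}} {x y} → n × x ≈ n × y → x ≈ y
  ×-cancelˡ n {x} {y} nx≈ny = begin
    x                     ≈⟨ undo x ⟨
    ⅟ n * (n × x)         ≈⟨ *-congˡ nx≈ny ⟩
    ⅟ n * (n × y)         ≈⟨ undo y ⟩
    y                     ∎
    where
    open ≈-Reasoning setoid
    undo : ∀ z → ⅟ n * (n × z) ≈ z
    undo z = begin
      ⅟ n * (n × z)         ≈⟨ *-congˡ (×1-* n z) ⟨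
      ⅟ n * ((n × 1#) * z)  ≈⟨ solve 3 (λ i m z → i :* (m :* z) := (m :* i) :* z) refl (⅟ n) (n × 1#) z ⟩
      (n × 1#) * ⅟ n * z    ≈⟨ *-congʳ (⅟-inverse n) ⟩
      1# * z                ≈⟨ *-identityˡ z ⟩
      z                     ∎

  ×-⅟-! : ∀ n → suc n × ⅟ (suc n !) {{suc n ℕ.!≢0}} ≈ ⅟ (n !) {{n ℕ.!≢0}}
  ×-⅟-! n = ⅟-unique (n !) {{n ℕ.!≢0}} (begin
    ((n !) × 1#) * (suc n × x)     ≈⟨ ×1-* (n !) _ ⟩
    (n !) × (suc n × x)            ≈⟨ ×-assocˡ x (n !) (suc n) ⟩
    (n ! ℕ.* suc n) × x            ≈⟨ reflexive (≡.cong (_× x) (ℕ.*-comm (n !) (suc n))) ⟩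
    (suc n !) × x                  ≈⟨ ×1-* (suc n !) x ⟨
    ((suc n !) × 1#) * x           ≈⟨ ⅟-inverse (suc n !) {{suc n ℕ.!≢0}} ⟩
    1#                             ∎)
    where
    open ≈-Reasoning setoid
    x = ⅟ (suc n !) {{suc n ℕ.!≢0}}

  θ-exp : ∀ a → θ (exp a) S.≈ (scalar a S.* (T S.* exp a))
  θ-exp a zero    = sym (trans (scalar-*ₛ a (T S.* exp a) 0) (trans (*-congˡ (T*-zero (exp a))) (zeroʳ a)))
  θ-exp a (suc n) = begin
    suc n × (x * (a * a ^ n))          ≈⟨ ×-assoc-* (suc n) x _ ⟨
    (suc n × x) * (a * a ^ n)          ≈⟨ *-congʳ (×-⅟-! n) ⟩
    y * (a * a ^ n)                    ≈⟨ solve 3 (λ y a p → y :* (a :* p) := a :* (y :* p)) refl y a (a ^ n) ⟩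
    a * (y * a ^ n)                    ≈⟨ *-congˡ (T*-suc (exp a) n) ⟨
    a * (T S.* exp a) (suc n)          ≈⟨ scalar-*ₛ a (T S.* exp a) (suc n) ⟨
    (scalar a S.* (T S.* exp a)) (suc n) ∎
    where
    open ≈-Reasoning setoid
    x = ⅟ (suc n !) {{suc n ℕ.!≢0}}
    y = ⅟ (n !) {{n ℕ.!≢0}}

  exp-0 : ∀ a → exp a 0 ≈ 1#
  exp-0 a = trans (*-identityʳ _) ⅟1≈1

  θ≈0⇒constant : ∀ {f} → θ f S.≈ S.0# → f S.≈ scalar (f 0)
  θ≈0⇒constant θf≈0 zero    = refl
  θ≈0⇒constant θf≈0 (suc n) =
    ×-cancelˡ (suc n) (trans (θf≈0 (suc n)) (sym (trans (sym (×1-* (suc n) 0#)) (zeroʳ _))))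

  -- Instead of a binomial sum: θ of the product is (a + b) t times the product, hence zero, and
  -- over a ℚ-algebra θ kills only constants.
  exp-*-inverse : ∀ {a b} → a + b ≈ 0# → (exp a S.* exp b) S.≈ S.1#
  exp-*-inverse {a} {b} a+b≈0 = SR.trans (θ≈0⇒constant θ≈0)
    (IsRingHomomorphism.⟦⟧-cong scalar-isRingHomomorphism
      (trans (+-identityʳ _) (trans (*-cong (exp-0 a) (exp-0 b)) (*-identityˡ 1#))))
    where
    open ≈-Reasoning SR.setoid
    open IsRingHomomorphism scalar-isRingHomomorphism using (+-homo; ⟦⟧-cong)
    θ≈0 : θ (exp a S.* exp b) S.≈ S.0#
    θ≈0 = begin
      θ (exp a S.* exp b)   ≈⟨ θ-* (exp a) (exp b) ⟩
      (θ (exp a) S.* exp b) S.+ (exp a S.* θ (exp b))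
        ≈⟨ SR.+-cong (SR.*-congʳ {x = exp b} (θ-exp a)) (SR.*-congˡ {x = exp a} (θ-exp b)) ⟩
      (scalar a S.* (T S.* exp a) S.* exp b) S.+ (exp a S.* (scalar b S.* (T S.* exp b)))
        ≈⟨ SL.solve 5 (λ a b t x y →
             a SL.:* (t SL.:* x) SL.:* y SL.:+ x SL.:* (b SL.:* (t SL.:* y))
             SL.:= (a SL.:+ b) SL.:* (t SL.:* x SL.:* y))
             SR.refl (scalar a) (scalar b) T (exp a) (exp b) ⟩
      (scalar a S.+ scalar b) S.* (T S.* exp a S.* exp b)
        ≈⟨ SR.*-congʳ {x = T S.* exp a S.* exp b} (SR.trans (SR.sym (+-homo a b)) (⟦⟧-cong a+b≈0)) ⟩
      S.0# S.* (T S.* exp a S.* exp b)  ≈⟨ SR.zeroˡ (T S.* exp a S.* exp b) ⟩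
      S.0#                  ∎

-- Change of coefficients and dilation of the variable.

module SeriesMap
  (R : CommutativeRing c ℓ) (S : CommutativeRing c′ ℓ′)
  {φ : CommutativeRing.Carrier R → CommutativeRing.Carrier S}
  (φ-homo : IsRingHomomorphism (CommutativeRing.rawRing R) (CommutativeRing.rawRing S) φ)
  where
  private
    module R = CommutativeRing R
    module S = CommutativeRing S
    module RS = PowerSeries R.rawRing
    module SS = PowerSeries S.rawRing
  open IsRingHomomorphism φ-homo
  open HomomorphismLemmas R S φ-homo using (sumUpTo-homo; ×-homo)
  open S using (_≈_)

  map-θ : ∀ f → (φ ∘ EulerDerivation.θ R f) SS.≈ EulerDerivation.θ S (φ ∘ f)
  map-θ f n = ×-homo n (f n)

  map-isRingHomomorphism : IsRingHomomorphism RS.seriesRing SS.seriesRing (φ ∘_)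
  map-isRingHomomorphism = record
    { isSemiringHomomorphism = record
      { isNearSemiringHomomorphism = record
        { +-isMonoidHomomorphism = record
          { isMagmaHomomorphism = record
            { isRelHomomorphism = record { cong = λ f≈g n → ⟦⟧-cong (f≈g n) }
            ; homo = λ f g n → +-homo (f n) (g n)
            }
          ; ε-homo = λ { zero → 0#-homo ; (suc n) → 0#-homo }
          }
        ; *-homo = λ f g n → S.trans (sumUpTo-homo n (λ i → f i R.* g (n ∸ i)))
            (RingLemmas.sumUpTo-cong S n _ (λ i → φ (f i) S.* φ (g (n ∸ i)))
              (λ i _ → *-homo (f i) (g (n ∸ i))))
        }
      ; 1#-homo = λ { zero → 1#-homo ; (suc n) → 0#-homo }
      }
    ; -‿homo = λ f n → -‿homo (f n)
    }

module Dilation (R : CommutativeRing c ℓ) where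
  open CommutativeRing R
  open RingLemmas R
  open SemiringExp semiring using (^-homo-*)
  open PowerSeries rawRing using (Series)
  private module S = PowerSeries rawRing
  open ≈-Reasoning setoid

  -- This is f(at). In the coefficientwise form multiplicativity is just aⁱ⁺ʲ = aⁱ aʲ.
  dilate : Carrier → Series → Series
  dilate a f n = a ^ n * f n

  dilate-+ : ∀ a f g → dilate a (f S.+ g) S.≈ (dilate a f S.+ dilate a g)
  dilate-+ a f g n = distribˡ (a ^ n) (f n) (g n)

  dilate-1 : ∀ a → dilate a S.1# S.≈ S.1#
  dilate-1 a zero    = *-identityˡ 1#
  dilate-1 a (suc n) = zeroʳ _

  dilate-* : ∀ a f g → dilate a (f S.* g) S.≈ (dilate a f S.* dilate a g)
  dilate-* a f g n = begin
    a ^ n * (f S.* g) n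
      ≈⟨ *-distribˡ-sumUpTo n (a ^ n) (λ i → f i * g (n ∸ i)) ⟩
    sumUpTo n (λ i → a ^ n * (f i * g (n ∸ i)))
      ≈⟨ sumUpTo-cong n _ (λ i → dilate a f i * dilate a g (n ∸ i))
           (λ i i≤n → split {i} {n ∸ i} (ℕ.m+[n∸m]≡n i≤n) (f i) (g (n ∸ i))) ⟩
    (dilate a f S.* dilate a g) n ∎
    where
    split : ∀ {i j n} → i ℕ.+ j ≡ n → ∀ x y → a ^ n * (x * y) ≈ (a ^ i * x) * (a ^ j * y)
    split {i} {j} ≡.refl x y = trans (*-congʳ (^-homo-* a i j))
      (solve 4 (λ p q x y → p :* q :* (x :* y) := p :* x :* (q :* y)) refl (a ^ i) (a ^ j) x y)

-- Differential relations of b and P_k in an abstract ring with derivation.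

module LogarithmicDerivatives (R : CommutativeRing c ℓ)
    {θ : CommutativeRing.Carrier R → CommutativeRing.Carrier R} (isDerivation : IsDerivation R θ)
  where
  open CommutativeRing R
  open RingLemmas R
  open DerivationLemmas R isDerivation
  open ≈-Reasoning setoid

  Cancellable : Carrier → Set _
  Cancellable a = ∀ x y → a * x ≈ a * y → x ≈ y

  -- The elements stand for t, eᵗ, e⁻ᵗ, eᵗ - 1, 1 - e⁻ᵗ and t/(eᵗ - 1).
  module BernoulliRelations {t e e′ w u b : Carrier}
      (t-cancel : Cancellable t) (u-cancel : Cancellable u)
      (θt≈t : θ t ≈ t) (θe≈te : θ e ≈ t * e) (θe′+te′≈0 : θ e′ + t * e′ ≈ 0#)
      (ee′≈1 : e * e′ ≈ 1#) (w+1≈e : w + 1# ≈ e) (u+e′≈1 : u + e′ ≈ 1#) (bw≈t : b * w ≈ t)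
    where

    θw≈te : θ w ≈ t * e
    θw≈te = begin
      θ w         ≈⟨ +-identityʳ _ ⟨
      θ w + 0#    ≈⟨ +-congˡ θ-1 ⟨
      θ w + θ 1#  ≈⟨ θ-+ w 1# ⟨
      θ (w + 1#)  ≈⟨ θ-cong w+1≈e ⟩
      θ e         ≈⟨ θe≈te ⟩
      t * e       ∎

    θu≈te′ : θ u ≈ t * e′
    θu≈te′ = +-cancelʳ (θ e′) (θ u) (t * e′) (begin
      θ u + θ e′     ≈⟨ θ-+ u e′ ⟨
      θ (u + e′)     ≈⟨ trans (θ-cong u+e′≈1) θ-1 ⟩
      0#             ≈⟨ θe′+te′≈0 ⟨
      θ e′ + t * e′  ≈⟨ +-comm _ _ ⟩
      t * e′ + θ e′  ∎)

    -- Links the denominators of b and P_k: together with bw = t it gives t = b u eᵗ, which replaces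
    -- the quotient e⁻ᵗ/u = b/t.
    ue≈w : u * e ≈ w
    ue≈w = +-cancelʳ 1# (u * e) w (begin
      u * e + 1#      ≈⟨ +-congˡ ee′≈1 ⟨
      u * e + e * e′  ≈⟨ solve 3 (λ u e f → u :* e :+ e :* f := (u :+ f) :* e) refl u e e′ ⟩
      (u + e′) * e    ≈⟨ *-congʳ u+e′≈1 ⟩
      1# * e          ≈⟨ *-identityˡ e ⟩
      e               ≈⟨ w+1≈e ⟨
      w + 1#          ∎)

    -- Apply θ to bw = t and multiply by b. With eᵗ = w + 1 every bw becomes t, so a common factor t
    -- appears and is cancelled.
    θb-equation : θ b + b * (t + b) ≈ b
    θb-equation = t-cancel _ _ (begin
      t * (θ b + b * (t + b))
        ≈⟨ solve 3 (λ t b d → t :* (d :+ b :* (t :+ b)) := t :* d :+ b :* t :* t :+ b :* b :* t)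
             refl t b (θ b) ⟩
      t * θ b + b * t * t + b * b * t
        ≈⟨ +-congʳ (+-cong (*-congʳ bw≈t) (*-congˡ bw≈t)) ⟨
      b * w * θ b + b * t * (b * w) + b * b * t
        ≈⟨ solve 4 (λ t b d w → b :* w :* d :+ b :* t :* (b :* w) :+ b :* b :* t
             := b :* (d :* w :+ b :* (t :* (w :+ con 1)))) refl t b (θ b) w ⟩
      b * (θ b * w + b * (t * (w + 1#)))
        ≈⟨ *-congˡ (+-congˡ (*-congˡ (trans (*-congˡ w+1≈e) (sym θw≈te)))) ⟩
      b * (θ b * w + b * θ w)      ≈⟨ *-congˡ (θ-* b w) ⟨
      b * θ (b * w)                ≈⟨ *-congˡ (trans (θ-cong bw≈t) θt≈t) ⟩
      b * t                        ≈⟨ *-comm b t ⟩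
      t * b                        ∎)

    -- l and l′ stand for Li_k(u) and Li_{k-1}(u). Applying θ to pu = l and cancelling u gives `eq`;
    -- multiplied by b eᵗ, it has t = b u eᵗ in front of θp and no exponentials left, so t cancels.
    θ-quotient : ∀ {p p′ l l′} → p * u ≈ l → p′ * u ≈ l′ → u * θ l ≈ l′ * θ u → θ p + b * p ≈ b * p′
    θ-quotient {p} {p′} {l} {l′} pu≈l p′u≈l′ uθl≈l′θu = t-cancel _ _ (begin
      t * (θ p + b * p)
        ≈⟨ distribˡ t (θ p) (b * p) ⟩
      t * θ p + t * (b * p)
        ≈⟨ +-cong (*-congʳ t≈bue) (sym (*-identityʳ _)) ⟩
      b * (u * e) * θ p + t * (b * p) * 1#
        ≈⟨ +-congˡ (*-congˡ ee′≈1) ⟨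
      b * (u * e) * θ p + t * (b * p) * (e * e′)
        ≈⟨ solve 7 (λ t b u e f p d → b :* (u :* e) :* d :+ t :* (b :* p) :* (e :* f)
             := b :* e :* (u :* d :+ p :* (t :* f))) refl t b u e e′ p (θ p) ⟩
      b * e * (u * θ p + p * (t * e′))
        ≈⟨ *-congˡ eq ⟩
      b * e * (p′ * (t * e′))
        ≈⟨ solve 5 (λ t b e f p → b :* e :* (p :* (t :* f)) := t :* (b :* p) :* (e :* f)) refl t b e e′ p′ ⟩
      t * (b * p′) * (e * e′)   ≈⟨ *-congˡ ee′≈1 ⟩
      t * (b * p′) * 1#         ≈⟨ *-identityʳ _ ⟩
      t * (b * p′)              ∎)
      where
      t≈bue : t ≈ b * (u * e)
      t≈bue = trans (sym bw≈t) (*-congˡ (sym ue≈w))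

      eq : u * θ p + p * (t * e′) ≈ p′ * (t * e′)
      eq = u-cancel _ _ (begin
        u * (u * θ p + p * (t * e′))   ≈⟨ *-congˡ (+-cong (*-comm _ _) (*-congˡ (sym θu≈te′))) ⟩
        u * (θ p * u + p * θ u)        ≈⟨ *-congˡ (θ-* p u) ⟨
        u * θ (p * u)                  ≈⟨ *-congˡ (θ-cong pu≈l) ⟩
        u * θ l                        ≈⟨ uθl≈l′θu ⟩
        l′ * θ u                       ≈⟨ *-cong (sym p′u≈l′) θu≈te′ ⟩
        p′ * u * (t * e′)              ≈⟨ solve 3 (λ p u x → p :* u :* x := u :* (p :* x)) refl p′ u (t * e′) ⟩
        u * (p′ * (t * e′))            ∎)

    -- a, w₋ and t₋ stand for the images of b, w and t under t ↦ -t.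
    reflection : ∀ {a w₋ t₋} → a * w₋ ≈ t₋ → w₋ + 1# ≈ e′ → t₋ + t ≈ 0# → a ≈ b + t
    -- Since w₋ is -u and t₋ is -t, adding `a * w₋` makes both sides vanish without any subtraction.
    reflection {a} {w₋} {t₋} aw₋≈t₋ w₋+1≈e′ t₋+t≈0 = u-cancel _ _ (+-cancelʳ (a * w₋) _ _ (begin
      u * a + a * w₋      ≈⟨ solve 3 (λ u a w → u :* a :+ a :* w := a :* (u :+ w)) refl u a w₋ ⟩
      a * (u + w₋)        ≈⟨ *-congˡ u+w₋≈0 ⟩
      a * 0#              ≈⟨ zeroʳ a ⟩
      0#                  ≈⟨ t₋+t≈0 ⟨
      t₋ + t              ≈⟨ +-comm t₋ t ⟩
      t + t₋              ≈⟨ +-cong (sym u[b+t]≈t) (sym aw₋≈t₋) ⟩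
      u * (b + t) + a * w₋  ∎))
      where
      u+w₋≈0 : u + w₋ ≈ 0#
      u+w₋≈0 = +-cancelʳ 1# (u + w₋) 0# (begin
        u + w₋ + 1#    ≈⟨ +-assoc u w₋ 1# ⟩
        u + (w₋ + 1#)  ≈⟨ +-congˡ w₋+1≈e′ ⟩
        u + e′         ≈⟨ u+e′≈1 ⟩
        1#             ≈⟨ +-identityˡ 1# ⟨
        0# + 1#        ∎)

      u[b+t]≈t : u * (b + t) ≈ t
      u[b+t]≈t = begin
        u * (b + t)        ≈⟨ *-congˡ (+-congˡ bw≈t) ⟨
        u * (b + b * w)    ≈⟨ solve 3 (λ u b w → u :* (b :+ b :* w) := b :* (u :* (w :+ con 1))) refl u b w ⟩
        b * (u * (w + 1#)) ≈⟨ *-congˡ (trans (*-congˡ w+1≈e) ue≈w) ⟩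
        b * w              ≈⟨ bw≈t ⟩
        t                  ∎

  module _ {t b b⁻¹ h p p′ : Carrier} (bb⁻¹≈1 : b * b⁻¹ ≈ 1#)
      (θb : θ b + b * (t + b) ≈ b) (θp : θ p + b * p ≈ b * p′) (h+1≈b+t : h + 1# ≈ b + t)
    where

    -- Puts 1 - t - b in the form `- h`, the logarithmic derivative that `θ-zpow` multiplies by the
    -- exponent.
    θb≈-h*b : θ b ≈ - h * b
    θb≈-h*b = +-cancelʳ (b * (t + b)) (θ b) (- h * b) (begin
      θ b + b * (t + b)        ≈⟨ θb ⟩
      b                        ≈⟨ solve 1 (λ b → b := con 0 :* b :+ b) refl b ⟩
      0# * b + b               ≈⟨ +-congʳ (*-congʳ (-‿inverseˡ h)) ⟨
      (- h + h) * b + b        ≈⟨ solve 3 (λ g h b → (g :+ h) :* b :+ b := g :* b :+ b :* (h :+ con 1))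
           refl (- h) h b ⟩
      - h * b + b * (h + 1#)   ≈⟨ +-congˡ (*-congˡ (trans h+1≈b+t (+-comm b t))) ⟩
      - h * b + b * (t + b)    ∎)

    -- The power bᵏ contributes -k h to the logarithmic derivative, which the second term cancels;
    -- what is left is bᵏ (θp + bp) = bᵏ⁺¹ p′.
    θ-zpow-* : ∀ k → θ (zpow b b⁻¹ k * p) + fromℤ k * (h * (zpow b b⁻¹ k * p))
                     + zpow b b⁻¹ (k ℤ.+ 1ℤ) * p
                   ≈ zpow b b⁻¹ (k ℤ.+ 1ℤ) * p′
    θ-zpow-* k = begin
      θ (z * p) + fromℤ k * (h * (z * p)) + zpow b b⁻¹ (k ℤ.+ 1ℤ) * p
        ≈⟨ +-cong (+-congʳ (trans (θ-* z p) (+-congʳ (*-congʳ (θ-zpow bb⁻¹≈1 θb≈-h*b k)))))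
             (*-congʳ (zpow-suc bb⁻¹≈1 k)) ⟩
      fromℤ k * - h * z * p + z * θ p + fromℤ k * (h * (z * p)) + b * z * p
        ≈⟨ solve 7 (λ r g h z p b d → r :* g :* z :* p :+ z :* d :+ r :* (h :* (z :* p)) :+ b :* z :* p
             := r :* (g :+ h) :* z :* p :+ z :* (d :+ b :* p)) refl (fromℤ k) (- h) h z p b (θ p) ⟩
      fromℤ k * (- h + h) * z * p + z * (θ p + b * p)
        ≈⟨ +-cong (*-congʳ (*-congʳ (*-congˡ (-‿inverseˡ h)))) (*-congˡ θp) ⟩
      fromℤ k * 0# * z * p + z * (b * p′)
        ≈⟨ solve 5 (λ r z p b q → r :* con 0 :* z :* p :+ z :* (b :* q) := b :* z :* q)
             refl (fromℤ k) z p b p′ ⟩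
      b * z * p′   ≈⟨ *-congʳ (zpow-suc bb⁻¹≈1 k) ⟨
      zpow b b⁻¹ (k ℤ.+ 1ℤ) * p′ ∎
      where z = zpow b b⁻¹ k

-- The concrete series over the ground ring.

module PolyBernoulliLemmas (A : CommutativeℚAlgebra c ℓ) where
  open CommutativeℚAlgebra A hiding (_×_)
  open PolyBernoulli A
  open RingLemmas commutativeRing
  open SemiringExp semiring using (^-congˡ)
  open SeriesLemmas commutativeRing
  open EulerDerivation commutativeRing
  open ℚAlgebraLemmas A
  open Dilation commutativeRing
  open LogarithmicDerivatives seriesCommutativeRing θ-isDerivation
  open PowerSeries rawRing using (Series; scalar; seriesRing; T; _⟪_⟫; inverse)
  private
    module S  = PowerSeries rawRing
    module SR = CommutativeRing seriesCommutativeRing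
    module SN = RingNotation seriesRing

  e^t-1 : Series
  e^t-1 = e^t S.- S.1#

  1^n≈1 : ∀ n → 1# ^ n ≈ 1#
  1^n≈1 zero    = refl
  1^n≈1 (suc n) = trans (*-identityˡ _) (1^n≈1 n)

  exp-1 : ∀ a → Exponential.exp rawRing ⅟ a 1 ≈ a
  exp-1 a = trans (*-cong ⅟1≈1 (*-identityʳ a)) (*-identityˡ a)

  e^t-1-0 : e^t-1 0 ≈ 0#
  e^t-1-0 = trans (+-congʳ (exp-0 1#)) (-‿inverseʳ 1#)

  e^t-1-1 : e^t-1 1 ≈ 1#
  e^t-1-1 = trans (+-cong (exp-1 1#) -0#≈0#) (+-identityʳ 1#)

  1-e^-t-0 : 1-e^-t 0 ≈ 0#
  1-e^-t-0 = trans (+-congˡ (-‿cong (exp-0 (- 1#)))) (-‿inverseʳ 1#)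

  1-e^-t-1 : 1-e^-t 1 ≈ 1#
  1-e^-t-1 = trans (+-identityˡ _) (trans (-‿cong (exp-1 (- 1#))) (-‿involutive 1#))

  t/[e^t-1]-0 : t/[e^t-1] 0 ≈ 1#
  t/[e^t-1]-0 = trans (+-identityʳ _) (trans (*-identityˡ _) (trans (+-identityʳ _) (*-identityˡ 1#)))

  θT≈T : θ T S.≈ T
  θT≈T zero          = refl
  θT≈T (suc zero)    = +-identityʳ 1#
  θT≈T (suc (suc n)) = trans (sym (×1-* (suc (suc n)) 0#)) (zeroʳ _)

  θe^t : θ e^t S.≈ (T S.* e^t)
  θe^t = SR.trans (θ-exp 1#) (SR.*-identityˡ (T S.* e^t))

  θe^-t : (θ e^-t S.+ (T S.* e^-t)) S.≈ S.0#
  θe^-t = SR.trans (SR.+-congʳ {x = T S.* e^-t} (θ-exp (- 1#)))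
    (SR.trans (SR.+-congˡ {x = scalar (- 1#) S.* (T S.* e^-t)} (SR.sym (SR.*-identityˡ (T S.* e^-t))))
    (SR.trans (SR.sym (SR.distribʳ (T S.* e^-t) (scalar (- 1#)) S.1#))
    (SR.trans (SR.*-congʳ {x = T S.* e^-t} -1+1≈0) (SR.zeroˡ (T S.* e^-t)))))
    where
    -1+1≈0 : (scalar (- 1#) S.+ S.1#) S.≈ S.0#
    -1+1≈0 zero    = -‿inverseˡ 1#
    -1+1≈0 (suc n) = +-identityˡ 0#

  [x-y]+y≈x : ∀ x y → ((x S.- y) S.+ y) S.≈ x
  [x-y]+y≈x x y = SR.trans (SR.+-assoc x (S.- y) y)
    (SR.trans (SR.+-congˡ {x = x} (SR.-‿inverseˡ y)) (SR.+-identityʳ x))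

  t/[e^t-1]-* : (t/[e^t-1] S.* e^t-1) S.≈ T
  t/[e^t-1]-* = /-* e^t-1-0 e^t-1-1 refl

  Li⟪1-e^-t⟫-0 : ∀ k → (Li k ⟪ 1-e^-t ⟫) 0 ≈ 0#
  Li⟪1-e^-t⟫-0 k = trans (+-identityʳ _) (zeroˡ _)

  polyBernoulliSeries-* : ∀ k → (polyBernoulliSeries k S.* 1-e^-t) S.≈ (Li k ⟪ 1-e^-t ⟫)
  polyBernoulliSeries-* k = /-* 1-e^-t-0 1-e^-t-1 (Li⟪1-e^-t⟫-0 k)

  -- The base of `zpow` is 1/n, so passing from k - 1 to k adds one factor 1/n, which the weight n
  -- cancels, whatever the sign of k.
  θ-Li : ∀ k → θ (Li k) S.≈ Li (k ℤ.- 1ℤ)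
  θ-Li k zero    = refl
  θ-Li k (suc m) = begin
    n × zpow a b k                      ≈⟨ ×1-* n _ ⟨
    b * zpow a b k                      ≈⟨ *-congˡ (reflexive (≡.cong (zpow a b) k≡[k-1]+1)) ⟩
    b * zpow a b (k ℤ.- 1ℤ ℤ.+ 1ℤ)      ≈⟨ *-congˡ (zpow-suc (trans (*-comm a b) (⅟-inverse n)) (k ℤ.- 1ℤ)) ⟩
    b * (a * zpow a b (k ℤ.- 1ℤ))       ≈⟨ *-assoc b a _ ⟨
    b * a * zpow a b (k ℤ.- 1ℤ)         ≈⟨ *-congʳ (⅟-inverse n) ⟩
    1# * zpow a b (k ℤ.- 1ℤ)            ≈⟨ *-identityˡ _ ⟩
    zpow a b (k ℤ.- 1ℤ)                 ∎
    where
    open ≈-Reasoning setoid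
    n = suc m
    a = ⅟ n
    b = n × 1#
    k≡[k-1]+1 : k ≡ k ℤ.- 1ℤ ℤ.+ 1ℤ
    k≡[k-1]+1 = ≡.sym (≡.trans (ℤ.+-assoc k (ℤ.- 1ℤ) 1ℤ) (ℤ.+-identityʳ k))

  θ-Li⟪1-e^-t⟫ : ∀ k → (1-e^-t S.* θ (Li k ⟪ 1-e^-t ⟫)) S.≈ ((Li (k ℤ.- 1ℤ) ⟪ 1-e^-t ⟫) S.* θ 1-e^-t)
  θ-Li⟪1-e^-t⟫ k = SR.trans (θ-⟪⟫ {1-e^-t} 1-e^-t-0 (Li k))
    (SR.*-congʳ {x = θ 1-e^-t} (⟪⟫-cong 1-e^-t (θ-Li k)))

  reflect : Series → Series
  reflect = dilate (- 1#)

  reflect-e^t : reflect e^t S.≈ e^-t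
  reflect-e^t n = trans (*-comm _ _) (*-congʳ (trans (*-congˡ (1^n≈1 n)) (*-identityʳ _)))

  reflect-T : (reflect T S.+ T) S.≈ S.0#
  reflect-T zero          = trans (+-identityʳ _) (zeroʳ _)
  reflect-T (suc zero)    = trans (+-congʳ (trans (*-identityʳ _) (*-identityʳ _))) (-‿inverseˡ 1#)
  reflect-T (suc (suc n)) = trans (+-identityʳ _) (zeroʳ _)

  open BernoulliRelations {T} {e^t} {e^-t} {e^t-1} {1-e^-t} {t/[e^t-1]}
    T*-cancelˡ (order1-*-cancelˡ {1-e^-t} 1-e^-t-0 1-e^-t-1)
    θT≈T θe^t θe^-t (exp-*-inverse (-‿inverseʳ 1#)) ([x-y]+y≈x e^t S.1#)
    ([x-y]+y≈x S.1# e^-t) t/[e^t-1]-*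

  -- Dilation is multiplicative, so b (eᵗ - 1) = t can be reflected factor by factor.
  reflect-t/[e^t-1] : reflect t/[e^t-1] S.≈ (t/[e^t-1] S.+ T)
  reflect-t/[e^t-1] = reflection {reflect t/[e^t-1]} {reflect e^t-1} {reflect T}
    (SR.trans (SR.sym (dilate-* (- 1#) t/[e^t-1] e^t-1)) (λ n → *-congˡ (t/[e^t-1]-* n)))
    (SR.trans (SR.+-congˡ {x = reflect e^t-1} (SR.sym (dilate-1 (- 1#))))
      (SR.trans (SR.sym (dilate-+ (- 1#) e^t-1 S.1#))
        (SR.trans (λ n → *-congˡ ([x-y]+y≈x e^t S.1# n)) reflect-e^t)))
    reflect-T

  θ-t/[e^t-1] : (θ t/[e^t-1] S.+ (t/[e^t-1] S.* (T S.+ t/[e^t-1]))) S.≈ t/[e^t-1]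
  θ-t/[e^t-1] = θb-equation

  θ-polyBernoulliSeries : ∀ k →
    (θ (polyBernoulliSeries k) S.+ (t/[e^t-1] S.* polyBernoulliSeries k))
      S.≈ (t/[e^t-1] S.* polyBernoulliSeries (k ℤ.- 1ℤ))
  θ-polyBernoulliSeries k = θ-quotient
    {polyBernoulliSeries k} {polyBernoulliSeries (k ℤ.- 1ℤ)}
    {Li k ⟪ 1-e^-t ⟫} {Li (k ℤ.- 1ℤ) ⟪ 1-e^-t ⟫}
    (polyBernoulliSeries-* k) (polyBernoulliSeries-* (k ℤ.- 1ℤ)) (θ-Li⟪1-e^-t⟫ k)

  -- By reflect-t/[e^t-1] this is t/(eᵗ - 1) + t - 1, but written so that its
  -- coefficients carry the signs (-1)ⁿ.
  H : Series
  H = reflect t/[e^t-1] S.- S.1#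

  G : ℤ → ℤ → Series
  G r k = t/[e^t-1]^ r S.* polyBernoulliSeries k

  θ-G : ∀ r k →
    ((θ (G r k) S.+ (SN.fromℤ r S.* (H S.* G r k))) S.+ G (r ℤ.+ 1ℤ) k) S.≈ G (r ℤ.+ 1ℤ) (k ℤ.- 1ℤ)
  θ-G r k = θ-zpow-* {T} {t/[e^t-1]} {inverse t/[e^t-1]} {H}
    {polyBernoulliSeries k} {polyBernoulliSeries (k ℤ.- 1ℤ)}
    (inverse-inverseʳ t/[e^t-1]-0) θ-t/[e^t-1] (θ-polyBernoulliSeries k)
    (SR.trans ([x-y]+y≈x (reflect t/[e^t-1]) S.1#) reflect-t/[e^t-1]) r

  H-0 : H 0 ≈ 0#
  H-0 = trans (+-congʳ (trans (*-identityˡ _) t/[e^t-1]-0)) (-‿inverseʳ 1#)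

  H-suc : ∀ n → H (suc n) ≈ (- 1#) ^ suc n * t/[e^t-1] (suc n)
  H-suc n = trans (+-congˡ -0#≈0#) (+-identityʳ _)

  -- One copy of H₁ is read as -b₁ and the other, by reflection, as b₁ + 1; hence 2 H₁ = 1 whatever
  -- b₁ is.
  H-1 : H 1 ≈ ⅟ 2
  H-1 = ⅟-unique 2 (begin
    (2 × 1#) * H 1                     ≈⟨ ×1-* 2 (H 1) ⟩
    H 1 + (H 1 + 0#)                   ≈⟨ +-congˡ (+-identityʳ _) ⟩
    H 1 + H 1                          ≈⟨ +-cong H₁ (trans H₁ (reflect-t/[e^t-1] 1)) ⟩
    reflect b 1 + (b 1 + 1#)           ≈⟨ +-congʳ (trans (*-congʳ (*-identityʳ _))
                                            (trans (sym (-‿distribˡ-* 1# (b 1))) (-‿cong (*-identityˡ _)))) ⟩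
    - b 1 + (b 1 + 1#)                 ≈⟨ +-assoc _ _ _ ⟨
    - b 1 + b 1 + 1#                   ≈⟨ +-congʳ (-‿inverseˡ _) ⟩
    0# + 1#                            ≈⟨ +-identityˡ 1# ⟩
    1#                                 ∎)
    where
    open ≈-Reasoning setoid
    b = t/[e^t-1]
    H₁ : H 1 ≈ reflect b 1
    H₁ = trans (+-congˡ -0#≈0#) (+-identityʳ _)

-- Passage to K[x], and the arithmetic of the final identity.

polyℚAlgebra : CommutativeℚAlgebra c ℓ → CommutativeℚAlgebra c ℓ
polyℚAlgebra A = record
  { commutativeRing = polyCommutativeRing
  -- The same reciprocals as in `e^xt`, so that the two exponential series agree by definition.
  ; ⅟               = λ n → const (⅟ n)
  ; ⅟-inverse       = λ n → begin
      (n P× const 1#) * const (⅟ n)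
        ≈⟨ P.*-congʳ {x = const (⅟ n)} {const (n × 1#)} {n P× const 1#} (×1-homo n) ⟨
      const (n × 1#) * const (⅟ n)       ≈⟨ *-homo (n × 1#) (⅟ n) ⟨
      const ((n × 1#) K.* ⅟ n)           ≈⟨ ⟦⟧-cong (⅟-inverse n) ⟩
      const 1#                           ∎
  }
  where
  open module K = CommutativeℚAlgebra A using (commutativeRing; rawRing; 1#; ⅟; ⅟-inverse; _×_)
  open PolynomialLemmas commutativeRing
  open Polynomial rawRing
  open HomomorphismLemmas commutativeRing polyCommutativeRing const-isRingHomomorphism
  open IsRingHomomorphism const-isRingHomomorphism
  module P = CommutativeRing polyCommutativeRing
  open RingNotation polyRing using (_*_) renaming (_×_ to _P×_)
  open ≈-Reasoning P.setoid

nCk*[n-k]!*k!≡n! : ∀ {n k} → k ≤ n → (n C k) ℕ.* (((n ∸ k) !) ℕ.* (k !)) ≡ n !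
nCk*[n-k]!*k!≡n! {n} {k} k≤n = ≡.trans (≡.cong₂ ℕ._*_ (nCk≡n!/k![n-k]! k≤n) (ℕ.*-comm ((n ∸ k) !) (k !)))
  (m/n*n≡m {{k ℕ.!* (n ∸ k) !≢0}} (k![n∸k]!∣n! k≤n))

module Rearrangement (R : CommutativeRing c ℓ) where
  open CommutativeRing R
  open RingLemmas R

  -- In use a and b are sₙ and sₙ₋₁, σ is the sum over l, ρ is r, h is 1/2, and d, d′ are the terms
  -- with r + 1. Adding `d + n × (x * b)` to both sides removes the subtractions.
  rearrange : ∀ n a σ b x ρ h d d′ →
    n × a + ρ * (σ + n × (h * b)) + d ≈ d′ + n × (x * b) →
    n × a + n × ((h * ρ - x) * b) + ρ * σ ≈ (- d) + d′
  rearrange n a σ b x ρ h d d′ eq = +-cancelʳ (d + n × (x * b)) _ _ (begin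
    n × a + n × ((h * ρ - x) * b) + ρ * σ + (d + n × (x * b))
      ≈⟨ +-cong (+-congʳ (+-congˡ (sym (×1-* n _)))) (+-congˡ (sym (×1-* n _))) ⟩
    n × a + N * ((h * ρ - x) * b) + ρ * σ + (d + N * (x * b))
      ≈⟨ solve 8 (λ na N q b x ρ σ d → na :+ N :* (q :* b) :+ ρ :* σ :+ (d :+ N :* (x :* b))
           := na :+ (ρ :* σ :+ N :* ((q :+ x) :* b)) :+ d) refl (n × a) N (h * ρ - x) b x ρ σ d ⟩
    n × a + (ρ * σ + N * ((h * ρ - x + x) * b)) + d
      ≈⟨ +-congʳ (+-congˡ (+-congˡ (*-congˡ (*-congʳ hρ-x+x)))) ⟩
    n × a + (ρ * σ + N * (h * ρ * b)) + d
      ≈⟨ solve 7 (λ na N h b ρ σ d → na :+ (ρ :* σ :+ N :* (h :* ρ :* b)) :+ d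
           := na :+ ρ :* (σ :+ N :* (h :* b)) :+ d) refl (n × a) N h b ρ σ d ⟩
    n × a + ρ * (σ + N * (h * b)) + d
      ≈⟨ +-congʳ (+-congˡ (*-congˡ (+-congˡ (×1-* n _)))) ⟩
    n × a + ρ * (σ + n × (h * b)) + d
      ≈⟨ eq ⟩
    d′ + n × (x * b)
      ≈⟨ trans (sym (+-identityˡ _)) (trans (+-congʳ (sym (-‿inverseˡ d)))
           (solve 4 (λ e d d′ y → e :+ d :+ (d′ :+ y) := e :+ d′ :+ (d :+ y)) refl (- d) d d′ (n × (x * b)))) ⟩
    (- d) + d′ + (d + n × (x * b)) ∎)
    where
    open ≈-Reasoning setoid
    N = n × 1#
    hρ-x+x : h * ρ - x + x ≈ h * ρ
    hρ-x+x = trans (+-assoc _ _ _) (trans (+-congˡ (-‿inverseˡ x)) (+-identityʳ _))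

-- The factor eˣᵗ and the comparison of coefficients.

module MixedSeriesLemmas (A A′ : CommutativeℚAlgebra c ℓ)
    {φ : CommutativeℚAlgebra.Carrier A → CommutativeℚAlgebra.Carrier A′}
    (φ-homo : IsRingHomomorphism (CommutativeℚAlgebra.rawRing A) (CommutativeℚAlgebra.rawRing A′) φ)
    (x : CommutativeℚAlgebra.Carrier A′)
  where
  open CommutativeℚAlgebra A using (⅟) renaming (commutativeRing to K)
  open CommutativeℚAlgebra A′ using () renaming (commutativeRing to P; ⅟ to ⅟′)
  open PolyBernoulli A using (B; t/[e^t-1])
  open PolyBernoulliLemmas A using (H; G; θ-G; H-0; H-1; H-suc)
  open CommutativeRing P
  open RingLemmas P
  open SeriesLemmas P
  open EulerDerivation P
  open ℚAlgebraLemmas A′ using (θ-exp)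
  open Exponential rawRing ⅟′ using (exp)
  open IsRingHomomorphism φ-homo using (⟦⟧-cong; *-homo; 0#-homo; 1#-homo; -‿homo)
  open SemiringExp semiring using (^-congˡ)
  open PowerSeries rawRing using (Series; scalar; T)
  private
    module K    = CommutativeRing K
    module K[t] = PowerSeries K.rawRing
    module KN = RingNotation K.rawRing
    module KS = RingNotation K[t].seriesRing
    module K[t]θ = EulerDerivation K
    module Const = HomomorphismLemmas K P φ-homo
    module S  = PowerSeries rawRing
    module SR = CommutativeRing seriesCommutativeRing
    module SL = RingLemmas seriesCommutativeRing
    module SN = RingNotation S.seriesRing
    open SeriesMap K P φ-homo
    module Map = IsRingHomomorphism map-isRingHomomorphism
    module MapL = HomomorphismLemmas
      (SeriesLemmas.seriesCommutativeRing K) seriesCommutativeRing map-isRingHomomorphism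

  φₛ : K[t].Series → Series
  φₛ f = φ ∘ f

  -- For φ = `const` and x = `X` this is `mixedSeries` by definition. An arbitrary homomorphism
  -- keeps the list encoding of polynomials out of the computation.
  mixed : ℤ → ℤ → Series
  mixed r k = φₛ (G r k) S.* exp x

  s : ℤ → ℤ → ℕ → Carrier
  s r k n = (n !) × mixed r k n

  θ-φₛ-G : ∀ r k →
    ((θ (φₛ (G r k)) S.+ (SN.fromℤ r S.* (φₛ H S.* φₛ (G r k)))) S.+ φₛ (G (r ℤ.+ 1ℤ) k))
      S.≈ φₛ (G (r ℤ.+ 1ℤ) (k ℤ.- 1ℤ))
  θ-φₛ-G r k = begin
    (θ (φₛ g) S.+ (SN.fromℤ r S.* (φₛ H S.* φₛ g))) S.+ φₛ g′
      ≈⟨ SR.+-congʳ {x = φₛ g′} (SR.+-cong (map-θ g)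
           (SR.trans (Map.*-homo (KS.fromℤ r) (H K[t].* g))
             (SR.*-cong (MapL.fromℤ-homo r) (Map.*-homo H g)))) ⟨
    (φₛ (K[t]θ.θ g) S.+ φₛ (KS.fromℤ r K[t].* (H K[t].* g))) S.+ φₛ g′
      ≈⟨ SR.trans (Map.+-homo (K[t]θ.θ g K[t].+ (KS.fromℤ r K[t].* (H K[t].* g))) g′)
           (SR.+-congʳ {x = φₛ g′} (Map.+-homo (K[t]θ.θ g) (KS.fromℤ r K[t].* (H K[t].* g)))) ⟨
    φₛ ((K[t]θ.θ g K[t].+ (KS.fromℤ r K[t].* (H K[t].* g))) K[t].+ g′)
      ≈⟨ Map.⟦⟧-cong (θ-G r k) ⟩
    φₛ (G (r ℤ.+ 1ℤ) (k ℤ.- 1ℤ)) ∎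
    where
    open ≈-Reasoning SR.setoid
    g  = G r k
    g′ = G (r ℤ.+ 1ℤ) k

  θ-mixed : ∀ r k →
    ((θ (mixed r k) S.+ (SN.fromℤ r S.* (φₛ H S.* mixed r k))) S.+ mixed (r ℤ.+ 1ℤ) k)
      S.≈ (mixed (r ℤ.+ 1ℤ) (k ℤ.- 1ℤ) S.+ (scalar x S.* (T S.* mixed r k)))
  θ-mixed r k = begin
    (θ (g S.* exp x) S.+ (ρ S.* (φₛ H S.* (g S.* exp x)))) S.+ (g′ S.* exp x)
      ≈⟨ SR.+-congʳ {x = g′ S.* exp x} (SR.+-congʳ {x = ρ S.* (φₛ H S.* (g S.* exp x))}
           (SR.trans (θ-* g (exp x)) (SR.+-congˡ {x = θ g S.* exp x} (SR.*-congˡ {x = g} (θ-exp x))))) ⟩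
    (((θ g S.* exp x) S.+ (g S.* (scalar x S.* (T S.* exp x)))) S.+ (ρ S.* (φₛ H S.* (g S.* exp x))))
      S.+ (g′ S.* exp x)
      ≈⟨ SL.solve 8 (λ dg e g x t ρ h g′ →
           ((dg SL.:* e SL.:+ g SL.:* (x SL.:* (t SL.:* e))) SL.:+ ρ SL.:* (h SL.:* (g SL.:* e)))
             SL.:+ g′ SL.:* e
           SL.:= ((dg SL.:+ ρ SL.:* (h SL.:* g)) SL.:+ g′) SL.:* e SL.:+ x SL.:* (t SL.:* (g SL.:* e)))
           SR.refl (θ g) (exp x) g (scalar x) T ρ (φₛ H) g′ ⟩
    (((θ g S.+ (ρ S.* (φₛ H S.* g))) S.+ g′) S.* exp x) S.+ (scalar x S.* (T S.* (g S.* exp x)))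
      ≈⟨ SR.+-congʳ {x = scalar x S.* (T S.* (g S.* exp x))} (SR.*-congʳ {x = exp x} (θ-φₛ-G r k)) ⟩
    mixed (r ℤ.+ 1ℤ) (k ℤ.- 1ℤ) S.+ (scalar x S.* (T S.* mixed r k)) ∎
    where
    open ≈-Reasoning SR.setoid
    ρ  = SN.fromℤ r
    g  = φₛ (G r k)
    g′ = φₛ (G (r ℤ.+ 1ℤ) k)

  fromℤ-*ₛ : ∀ r f n → (SN.fromℤ r S.* f) n ≈ fromℤ r * f n
  fromℤ-*ₛ r f n = trans
    (SR.*-congʳ {x = f} (SR.sym {x = scalar (fromℤ r)}
      (HomomorphismLemmas.fromℤ-homo P seriesCommutativeRing scalar-isRingHomomorphism r)) n)
    (scalar-*ₛ (fromℤ r) f n)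

  mixed-coefficient : ∀ r k n →
    suc n × mixed r k (suc n) + fromℤ r * (φₛ H S.* mixed r k) (suc n) + mixed (r ℤ.+ 1ℤ) k (suc n)
      ≈ mixed (r ℤ.+ 1ℤ) (k ℤ.- 1ℤ) (suc n) + x * mixed r k n
  mixed-coefficient r k n = begin
    suc n × F (suc n) + fromℤ r * (φₛ H S.* F) (suc n) + F′ (suc n)
      ≈⟨ +-congʳ (+-congˡ (fromℤ-*ₛ r (φₛ H S.* F) (suc n))) ⟨
    suc n × F (suc n) + (SN.fromℤ r S.* (φₛ H S.* F)) (suc n) + F′ (suc n)
      ≈⟨ θ-mixed r k (suc n) ⟩
    F″ (suc n) + (scalar x S.* (T S.* F)) (suc n)
      ≈⟨ +-congˡ (trans (scalar-*ₛ x (T S.* F) (suc n)) (*-congˡ (T*-suc F n))) ⟩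
    F″ (suc n) + x * F n ∎
    where
    open ≈-Reasoning setoid
    F  = mixed r k
    F′ = mixed (r ℤ.+ 1ℤ) k
    F″ = mixed (r ℤ.+ 1ℤ) (k ℤ.- 1ℤ)

  summand : ℤ → ℤ → ℕ → ℕ → Carrier
  summand r k n l = ((- 1#) ^ (n ∸ l)) * ((n C l) × (φ (B (n ∸ l)) * s r k l))

  -- From n! = C(n,l) (n-l)! l!, the factor (n-l)! completes the Bernoulli number and l! completes
  -- s_l. With l < n the index of H is positive, away from the subtracted 1.
  !×-summand : ∀ r k {n l} → l < n → (n !) × (mixed r k l * φ (H (n ∸ l))) ≈ summand r k n l
  !×-summand r k {n} {l} l<n = begin
    (n !) × (f * φ (H m))
      ≈⟨ ×-congʳ (n !) (*-congˡ (⟦⟧-cong H-m)) ⟩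
    (n !) × (f * φ ((K.- K.1#) KN.^ m K.* b))
      ≈⟨ ×-congʳ (n !) (*-congˡ (trans (*-homo ((K.- K.1#) KN.^ m) b) (*-congʳ φ[-1]^m))) ⟩
    (n !) × (f * (ε * φ b))
      ≈⟨ ×1-* (n !) (f * (ε * φ b)) ⟨
    ((n !) × 1#) * (f * (ε * φ b))
      ≈⟨ *-congʳ n!×1 ⟩
    ((n C l) × 1#) * (((m !) × 1#) * ((l !) × 1#)) * (f * (ε * φ b))
      ≈⟨ solve 6 (λ N M L f e b → N :* (M :* L) :* (f :* (e :* b)) := e :* (N :* ((M :* b) :* (L :* f))))
           refl ((n C l) × 1#) ((m !) × 1#) ((l !) × 1#) f ε (φ b) ⟩
    ε * (((n C l) × 1#) * ((((m !) × 1#) * φ b) * (((l !) × 1#) * f)))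
      ≈⟨ *-congˡ (trans (×1-* (n C l) ((((m !) × 1#) * φ b) * (((l !) × 1#) * f)))
           (×-congʳ (n C l) (*-cong (trans (×1-* (m !) (φ b)) (sym (Const.×-homo (m !) b))) (×1-* (l !) f)))) ⟩
    summand r k n l ∎
    where
    open ≈-Reasoning setoid
    m = n ∸ l
    f = mixed r k l
    b = t/[e^t-1] m
    ε = (- 1#) ^ m
    instance
      m≢0 : NonZero m
      m≢0 = ℕ.>-nonZero (ℕ.m<n⇒0<n∸m l<n)
    H-pos : ∀ j .{{_ : NonZero j}} → H j K.≈ (K.- K.1#) KN.^ j K.* t/[e^t-1] j
    H-pos (suc j) = H-suc j
    H-m : H m K.≈ (K.- K.1#) KN.^ m K.* b
    H-m = H-pos m
    φ[-1]^m : φ ((K.- K.1#) KN.^ m) ≈ ε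
    φ[-1]^m = trans (Const.^-homo (K.- K.1#) m)
      (^-congˡ m (trans (-‿homo K.1#) (-‿cong 1#-homo)))
    n!×1 : (n !) × 1# ≈ ((n C l) × 1#) * (((m !) × 1#) * ((l !) × 1#))
    n!×1 = trans (reflexive (≡.cong (_× 1#) (≡.sym (nCk*[n-k]!*k!≡n! (ℕ.<⇒≤ l<n)))))
      (trans (×1-homo-* (n C l) ((m !) ℕ.* (l !))) (*-congˡ (×1-homo-* (m !) (l !))))

  !×-suc : ∀ m y → (suc m !) × y ≈ suc m × ((m !) × y)
  !×-suc m y = sym (×-assocˡ y (suc m) (m !))

  -- The factors are exchanged so that l indexes the mixed series. The term l = n drops out since H₀
  -- = 0, and l = n - 1 leaves the sum with H₁ = 1/2, which is why the sum stops at n - 2.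
  !×-H* : ∀ r k m → let n = suc (suc m) in
    (n !) × (φₛ H S.* mixed r k) n ≈ sumUpTo m (summand r k n) + n × (φ (⅟ 2) * s r k (suc m))
  !×-H* r k m = begin
    (n !) × (φₛ H S.* F) n        ≈⟨ ×-congʳ (n !) (*-commₛ (φₛ H) F n) ⟩
    (n !) × sumUpTo n ψ               ≈⟨ ×-congʳ (n !) (trans
                                           (sumUpTo-suc (suc m) ψ) (+-congʳ (sumUpTo-suc m ψ))) ⟩
    (n !) × (sumUpTo m ψ + ψ (suc m) + ψ n)
      ≈⟨ ×-congʳ (n !) (trans (+-congˡ ψn≈0) (+-identityʳ (sumUpTo m ψ + ψ (suc m)))) ⟩
    (n !) × (sumUpTo m ψ + ψ (suc m)) ≈⟨ ×-distrib-+ (sumUpTo m ψ) (ψ (suc m)) (n !) ⟩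
    (n !) × sumUpTo m ψ + (n !) × ψ (suc m)
      ≈⟨ +-cong sum-eq last-eq ⟩
    sumUpTo m (summand r k n) + n × (φ (⅟ 2) * s r k (suc m)) ∎
    where
    open ≈-Reasoning setoid
    n = suc (suc m)
    F = mixed r k
    ψ : ℕ → Carrier
    ψ l = F l * φ (H (n ∸ l))

    ψn≈0 : ψ n ≈ 0#
    ψn≈0 = begin
      F n * φ (H (n ∸ n))   ≈⟨ *-congˡ (reflexive (≡.cong (λ j → φ (H j)) (ℕ.n∸n≡0 n))) ⟩
      F n * φ (H 0)         ≈⟨ *-congˡ (trans (⟦⟧-cong H-0) 0#-homo) ⟩
      F n * 0#                  ≈⟨ zeroʳ (F n) ⟩
      0#                        ∎

    sum-eq : (n !) × sumUpTo m ψ ≈ sumUpTo m (summand r k n)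
    sum-eq = begin
      (n !) × sumUpTo m ψ                        ≈⟨ ×1-* (n !) (sumUpTo m ψ) ⟨
      ((n !) × 1#) * sumUpTo m ψ                 ≈⟨ *-distribˡ-sumUpTo m ((n !) × 1#) ψ ⟩
      sumUpTo m (λ l → ((n !) × 1#) * ψ l)
        ≈⟨ sumUpTo-cong m (λ l → ((n !) × 1#) * ψ l) (summand r k n) (λ l l≤m →
             trans (×1-* (n !) (ψ l)) (!×-summand r k (ℕ.≤-trans (s≤s l≤m) (ℕ.n≤1+n (suc m))))) ⟩
      sumUpTo m (summand r k n)                  ∎

    last-eq : (n !) × ψ (suc m) ≈ n × (φ (⅟ 2) * s r k (suc m))
    last-eq = begin
      (n !) × (F (suc m) * φ (H (n ∸ suc m)))
        ≈⟨ ×-congʳ (n !) (*-congˡ (trans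
             (reflexive (≡.cong (λ j → φ (H j)) (ℕ.m+n∸n≡m 1 (suc m)))) (⟦⟧-cong H-1))) ⟩
      (n !) × (F (suc m) * φ (⅟ 2))
        ≈⟨ ×-congʳ (n !) (*-comm (F (suc m)) (φ (⅟ 2))) ⟩
      (n !) × (φ (⅟ 2) * F (suc m))
        ≈⟨ !×-suc (suc m) (φ (⅟ 2) * F (suc m)) ⟩
      n × ((suc m !) × (φ (⅟ 2) * F (suc m)))
        ≈⟨ ×-congʳ n (×-comm-* (suc m !) (φ (⅟ 2)) (F (suc m))) ⟨
      n × (φ (⅟ 2) * s r k (suc m)) ∎

  s-equation : ∀ r k m → let n = suc (suc m) in
    n × s r k n + fromℤ r * (sumUpTo m (summand r k n) + n × (φ (⅟ 2) * s r k (suc m))) + s (r ℤ.+ 1ℤ) k n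
      ≈ s (r ℤ.+ 1ℤ) (k ℤ.- 1ℤ) n + n × (x * s r k (suc m))
  s-equation r k m = begin
    n × s r k n + fromℤ r * (sumUpTo m (summand r k n) + n × (φ (⅟ 2) * s r k (suc m))) + s (r ℤ.+ 1ℤ) k n
      ≈⟨ +-congʳ (+-cong (trans (×-assocˡ (F n) n (n !))
           (trans (reflexive (≡.cong (_× F n) (ℕ.*-comm n (n !)))) (sym (×-assocˡ (F n) (n !) n))))
           (trans (*-congˡ (sym (!×-H* r k m))) (×-comm-* (n !) (fromℤ r) ((φₛ H S.* F) n)))) ⟩
    (n !) × (n × F n) + (n !) × (fromℤ r * (φₛ H S.* F) n) + (n !) × F′ n
      ≈⟨ trans (×-distrib-+ (n × F n + fromℤ r * (φₛ H S.* F) n) (F′ n) (n !))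
           (+-congʳ (×-distrib-+ (n × F n) (fromℤ r * (φₛ H S.* F) n) (n !))) ⟨
    (n !) × (n × F n + fromℤ r * (φₛ H S.* F) n + F′ n)
      ≈⟨ ×-congʳ (n !) (mixed-coefficient r k (suc m)) ⟩
    (n !) × (F″ n + x * F (suc m))
      ≈⟨ ×-distrib-+ (F″ n) (x * F (suc m)) (n !) ⟩
    (n !) × F″ n + (n !) × (x * F (suc m))
      -- The factor t has lowered the index to n - 1; (n-1)! is absorbed into s, and one factor n
      -- remains.
      ≈⟨ +-congˡ (trans (!×-suc (suc m) (x * F (suc m)))
           (×-congʳ n (sym (×-comm-* (suc m !) x (F (suc m)))))) ⟩
    s (r ℤ.+ 1ℤ) (k ℤ.- 1ℤ) n + n × (x * s r k (suc m)) ∎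
    where
    open ≈-Reasoning setoid
    n  = suc (suc m)
    F  = mixed r k
    F′ = mixed (r ℤ.+ 1ℤ) k
    F″ = mixed (r ℤ.+ 1ℤ) (k ℤ.- 1ℤ)

theorem3 :
  ∀ {c ℓ} (A : CommutativeℚAlgebra c ℓ) →
  let module K = CommutativeℚAlgebra A
      open PolyBernoulli A
      open RingNotation polyRing
  in
  (n : ℕ) → 2 ≤ n → (r k : ℤ) →
    n × s r k n
      + n × ((const (K.⅟ 2) * fromℤ r - X) * s r k (n ∸ 1))
      + fromℤ r * (∑[ l ≤ n ∸ 2 ] (((- 1#) ^ (n ∸ l)) * ((n C l) × (const (B (n ∸ l)) * s r k l))))
    ≈ (- s (r ℤ.+ 1ℤ) k n) + s (r ℤ.+ 1ℤ) (k ℤ.- 1ℤ) n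
theorem3 A (suc (suc m)) (s≤s (s≤s z≤n)) r k =
  -- With n = m + 2 the bounds `n ∸ 1` and `n ∸ 2` compute, so the abstract identity at φ = `const`
  -- has the required form definitionally.
  Rearrangement.rearrange K[x] n (s r k n) (sumUpTo m (summand r k n)) (s r k (suc m))
    X (fromℤ r) (const (⅟ 2)) (s (r ℤ.+ 1ℤ) k n) (s (r ℤ.+ 1ℤ) (k ℤ.- 1ℤ) n) (s-equation r k m)
  where
  open CommutativeℚAlgebra A using (⅟; commutativeRing)
  open PolyBernoulli A
  open RingNotation polyRing
  open PolynomialLemmas commutativeRing using () renaming (polyCommutativeRing to K[x])
  open MixedSeriesLemmas A (polyℚAlgebra A)
    (PolynomialLemmas.const-isRingHomomorphism commutativeRing) X using (summand; s-equation)
  n = suc (suc m)
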